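{- $G_n$ is perfect if and only if $n$ is even, or $n = p^m$ (a power of $p$) for $p \equiv 3 \pmod 4$ prime.
   Context: For an integer $n \ge 1$, $\mathbb{Z}_n$ is the ring of integers modulo $n$ and $\mathbb{Z}_n^\times$ its group of multiplicative units. Let $Q_n = \{u^2 : u \in \mathbb{Z}_n^\times\}$ and $T_n = \pm Q_n = \{\pm u^2 : u \in \mathbb{Z}_n^\times\}$. The (undirected) quadratic unitary Cayley graph $G_n = \mathrm{Cay}(\mathbb{Z}_n, T_n)$ is the graph with vertex set $\mathbb{Z}_n$ in which $a,b$ are adjacent if and only if $a-b \in T_n$. A graph $G$ is perfect if, for every induced subgraph $H$ of $G$, the size of the maximum clique in $H$ is equal to the chromatic number of $H$. -}

module Defs where

open import Algebra.Bundles using (CommutativeRing)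
open import Algebra.Definitions using (Invertible)
import Algebra.Properties.Ring as RingProperties
open import Data.Fin.Base using (Fin; toℕ)
open import Data.Fin.Properties using (toℕ-injective; toℕ-fromℕ<; toℕ<n; toℕ≤n)
open import Data.Fin.Subset using (Subset; _∈_)
import Data.Nat.Base as ℕ
open import Data.Nat.Base using (ℕ; NonZero; _≤_; _∸_; _%_)
open import Data.Nat.DivMod
  using (_mod_; m<n⇒m%n≡m; n%n≡0; m%n<n; %-distribˡ-+; %-distribˡ-*)
import Data.Nat.Properties as ℕₚ
open import Data.Product.Base using (Σ-syntax; ∃-syntax; _×_; _,_; proj₁)
open import Data.Sum.Base using (_⊎_; inj₁; inj₂)
open import Level using (0ℓ)
open import Relation.Binary.Core using (Rel)
open import Relation.Binary.Definitions using (Irreflexive; Symmetric)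
open import Relation.Binary.PropositionalEquality
open import Relation.Unary using (Pred)

record Graph (V : Set) : Set₁ where
  field
    Adj         : Rel V 0ℓ
    symmetric   : Symmetric Adj
    irreflexive : Irreflexive _≡_ Adj

induced : ∀ {n} → Graph (Fin n) → (S : Subset n) → Graph (∃[ v ] v ∈ S)
induced G S = record
  { Adj         = λ u v → G.Adj (proj₁ u) (proj₁ v)
  ; symmetric   = G.symmetric
  ; irreflexive = λ u≡v → G.irreflexive (cong proj₁ u≡v)
  }
  where module G = Graph G

module _ {V : Set} (G : Graph V) where
  open Graph G using (Adj)

  -- The k vertices of a clique are automatically distinct, since Adj is
  -- irreflexive.
  Clique : ℕ → Set
  Clique k = Σ[ f ∈ (Fin k → V) ] (∀ i j → i ≢ j → Adj (f i) (f j))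

  Colouring : ℕ → Set
  Colouring k = Σ[ c ∈ (V → Fin k) ] (∀ u v → Adj u v → c u ≢ c v)

  IsCliqueNumber : ℕ → Set
  IsCliqueNumber k = Clique k × (∀ j → Clique j → j ≤ k)

  IsChromaticNumber : ℕ → Set
  IsChromaticNumber k = Colouring k × (∀ j → Colouring j → k ≤ j)

Perfect : ∀ {n} → Graph (Fin n) → Set
Perfect {n} G = ∀ (S : Subset n) →
  ∃[ k ] IsCliqueNumber (induced G S) k × IsChromaticNumber (induced G S) k

module _ (n : ℕ) .{{_ : NonZero n}} where

  private
    infixl 6 _+_
    infixl 7 _*_

    _+_ _*_ : Fin n → Fin n → Fin n
    x + y = (toℕ x ℕ.+ toℕ y) mod n
    x * y = (toℕ x ℕ.* toℕ y) mod n

    -_ : Fin n → Fin n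
    - x = (n ∸ toℕ x) mod n

    toℕ-mod : ∀ a → toℕ (a mod n) ≡ a % n
    toℕ-mod a = toℕ-fromℕ< (m%n<n a n)

    mod-cong : ∀ {a b} → a % n ≡ b % n → a mod n ≡ b mod n
    mod-cong {a} {b} eq =
      toℕ-injective (trans (toℕ-mod a) (trans eq (sym (toℕ-mod b))))

    mod-toℕ : ∀ x → toℕ x mod n ≡ x
    mod-toℕ x =
      toℕ-injective (trans (toℕ-mod (toℕ x)) (m<n⇒m%n≡m (toℕ<n x)))

    mod-+ : ∀ a b → (a mod n) + (b mod n) ≡ (a ℕ.+ b) mod n
    mod-+ a b = mod-cong (trans
      (cong₂ (λ x y → (x ℕ.+ y) % n) (toℕ-mod a) (toℕ-mod b))
      (sym (%-distribˡ-+ a b n)))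

    mod-* : ∀ a b → (a mod n) * (b mod n) ≡ (a ℕ.* b) mod n
    mod-* a b = mod-cong (trans
      (cong₂ (λ x y → (x ℕ.* y) % n) (toℕ-mod a) (toℕ-mod b))
      (sym (%-distribˡ-* a b n)))

    mod-+ˡ : ∀ a z → (a mod n) + z ≡ (a ℕ.+ toℕ z) mod n
    mod-+ˡ a z = trans (cong ((a mod n) +_) (sym (mod-toℕ z))) (mod-+ a (toℕ z))

    mod-*ˡ : ∀ a z → (a mod n) * z ≡ (a ℕ.* toℕ z) mod n
    mod-*ˡ a z = trans (cong ((a mod n) *_) (sym (mod-toℕ z))) (mod-* a (toℕ z))

    +-comm : ∀ x y → x + y ≡ y + x
    +-comm x y = cong (_mod n) (ℕₚ.+-comm (toℕ x) (toℕ y))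

    *-comm : ∀ x y → x * y ≡ y * x
    *-comm x y = cong (_mod n) (ℕₚ.*-comm (toℕ x) (toℕ y))

    +-assoc : ∀ x y z → (x + y) + z ≡ x + (y + z)
    +-assoc x y z = begin
      (x + y) + z                          ≡⟨ mod-+ˡ _ z ⟩
      (toℕ x ℕ.+ toℕ y ℕ.+ toℕ z) mod n    ≡⟨ cong (_mod n) (ℕₚ.+-assoc (toℕ x) _ _) ⟩
      (toℕ x ℕ.+ (toℕ y ℕ.+ toℕ z)) mod n  ≡⟨ mod-+ (toℕ x) _ ⟨
      (toℕ x mod n) + (y + z)              ≡⟨ cong (_+ (y + z)) (mod-toℕ x) ⟩
      x + (y + z)                          ∎
      where open ≡-Reasoning

    *-assoc : ∀ x y z → (x * y) * z ≡ x * (y * z)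
    *-assoc x y z = begin
      (x * y) * z                          ≡⟨ mod-*ˡ _ z ⟩
      (toℕ x ℕ.* toℕ y ℕ.* toℕ z) mod n    ≡⟨ cong (_mod n) (ℕₚ.*-assoc (toℕ x) _ _) ⟩
      (toℕ x ℕ.* (toℕ y ℕ.* toℕ z)) mod n  ≡⟨ mod-* (toℕ x) _ ⟨
      (toℕ x mod n) * (y * z)              ≡⟨ cong (_* (y * z)) (mod-toℕ x) ⟩
      x * (y * z)                          ∎
      where open ≡-Reasoning

    +-identityˡ : ∀ x → (0 mod n) + x ≡ x
    +-identityˡ x = trans (mod-+ˡ 0 x) (mod-toℕ x)

    *-identityˡ : ∀ x → (1 mod n) * x ≡ x
    *-identityˡ x = trans (mod-*ˡ 1 x)
      (trans (cong (_mod n) (ℕₚ.*-identityˡ (toℕ x))) (mod-toℕ x))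

    -‿inverseˡ : ∀ x → (- x) + x ≡ 0 mod n
    -‿inverseˡ x = begin
      (- x) + x                    ≡⟨ mod-+ˡ _ x ⟩
      (n ∸ toℕ x ℕ.+ toℕ x) mod n  ≡⟨ cong (_mod n) (ℕₚ.m∸n+n≡m (toℕ≤n x)) ⟩
      n mod n                      ≡⟨ mod-cong (trans (n%n≡0 n) (sym (m<n⇒m%n≡m (ℕ.>-nonZero⁻¹ n)))) ⟩
      0 mod n                      ∎
      where open ≡-Reasoning

    distribʳ : ∀ x y z → (y + z) * x ≡ y * x + z * x
    distribʳ x y z = begin
      (y + z) * x                                    ≡⟨ mod-*ˡ _ x ⟩
      ((toℕ y ℕ.+ toℕ z) ℕ.* toℕ x) mod n            ≡⟨ cong (_mod n) (ℕₚ.*-distribʳ-+ (toℕ x) (toℕ y) _) ⟩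
      (toℕ y ℕ.* toℕ x ℕ.+ toℕ z ℕ.* toℕ x) mod n    ≡⟨ mod-+ (toℕ y ℕ.* toℕ x) _ ⟨
      y * x + z * x                                  ∎
      where open ≡-Reasoning

  -- The integers modulo n, represented by the residues 0, …, n - 1.
  ℤ/ : CommutativeRing 0ℓ 0ℓ
  ℤ/ = record
    { Carrier = Fin n
    ; _≈_     = _≡_
    ; _+_     = _+_
    ; _*_     = _*_
    ; -_      = -_
    ; 0#      = 0 mod n
    ; 1#      = 1 mod n
    ; isCommutativeRing = record
      { isRing = record
        { +-isAbelianGroup = record
          { isGroup = record
            { isMonoid = record
              { isSemigroup = record
                { isMagma = record { isEquivalence = isEquivalence ; ∙-cong = cong₂ _+_ }
                ; assoc   = +-assoc
                }
              ; identity = +-identityˡ , λ x → trans (+-comm x _) (+-identityˡ x)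
              }
            ; inverse = -‿inverseˡ , λ x → trans (+-comm x _) (-‿inverseˡ x)
            ; ⁻¹-cong = cong -_
            }
          ; comm = +-comm
          }
        ; *-cong     = cong₂ _*_
        ; *-assoc    = *-assoc
        ; *-identity = *-identityˡ , λ x → trans (*-comm x _) (*-identityˡ x)
        ; distrib    = (λ x y z → trans (*-comm x _)
                          (trans (distribʳ x y z) (cong₂ _+_ (*-comm y x) (*-comm z x))))
                     , distribʳ
        }
      ; *-comm = *-comm
      }
    }

module _ (n : ℕ) .{{_ : NonZero n}} where

  private
    module R = CommutativeRing (ℤ/ n)
    open RingProperties R.ring using (-‿involutive; -‿anti-homo-+)
    open R using (_+_; _*_; _-_; -_; 1#; _≈_)

  Cay : (S : Pred (Fin n) 0ℓ) → (∀ {x} → S x → S (- x)) → Graph (Fin n)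
  Cay S S-neg = record
    -- The condition a ≢ b only matters when 0 ∈ S. As 0 is a unit of ℤ/ 1
    -- alone, for the set T below it only removes the loop in the case n = 1.
    { Adj         = λ a b → a ≢ b × S (a - b)
    ; symmetric   = λ { {a} {b} (a≢b , s) → ≢-sym a≢b , subst S (neg-sub a b) (S-neg s) }
    ; irreflexive = λ a≡b (a≢b , _) → a≢b a≡b
    }
    where
    neg-sub : ∀ a b → - (a - b) ≡ b - a
    neg-sub a b = trans (-‿anti-homo-+ a (- b)) (cong (_+ (- a)) (-‿involutive b))

  Unit : Pred (Fin n) 0ℓ
  Unit = Invertible _≈_ 1# _*_

  Q : Pred (Fin n) 0ℓ
  Q x = ∃[ u ] Unit u × x ≡ u * u

  T : Pred (Fin n) 0ℓ
  T x = ∃[ q ] Q q × (x ≡ q ⊎ x ≡ - q)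

  T-neg : ∀ {x} → T x → T (- x)
  T-neg (q , q∈Q , inj₁ x≡q)  = q , q∈Q , inj₂ (cong -_ x≡q)
  T-neg (q , q∈Q , inj₂ x≡-q) = q , q∈Q , inj₁ (trans (cong -_ x≡-q) (-‿involutive q))

  QuadraticUnitaryCayley : Graph (Fin n)
  QuadraticUnitaryCayley = Cay T T-neg

{-# OPTIONS --safe #-}
-- For even n every edge joins residues of opposite parity. For n = p^m with p ≡ 3
-- (mod 4) every unit is ± a square: if x^h ≡ ± 1 (mod p) with h = (p - 1)/2 odd, then
-- ± x has odd order modulo p^m. So the graph is complete multipartite, with the
-- residues modulo p as parts.
--
-- Conversely let n be odd and q its least prime factor. Cliques have at most q
-- vertices, and if the chromatic number equals the clique number ω, then counting the
-- translates of a maximum clique that meet a colour class gives ω ∣ n, so ω = q. For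
-- q ≡ 1 (mod 4) the q - 1 differences from one vertex of such a clique would be
-- distinct roots of x^((q-1)/2) = 1 modulo q, which is too many.
--
-- For q ≡ 3 (mod 4) and n = q^a N with q ∤ N and N > 1, the residues modulo q^a contain
-- a directed triangle whose steps are squares. Sending an integer x to the vertex that
-- is ≡ x (mod N) and lies modulo q^a over the corner given by x mod 3 preserves and
-- reflects adjacency from the Cayley graph on ℤ with connection set
-- L = {x : x ≡ ε (mod 3), ε x a unit square modulo N, ε = ± 1}. If m is the least positive
-- integer prime to 3 outside L, and M = ± m ≡ -1 (mod 3), then
-- 0, M - 1, M, 2 M - 1, M² is an induced pentagon.
module Submission where

open import Defs
open import Algebra.Bundles using (CommutativeMonoid; CommutativeRing)
import Algebra.Properties.CommutativeMonoid.Sum as Sum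
import Algebra.Properties.Group as GroupProperties
open import Data.Bool.Base using (if_then_else_)
open import Data.Fin.Base as Fin using (Fin; zero; suc; toℕ; fromℕ<; punchIn; punchOut)
open import Data.Fin.Patterns
open import Data.Fin.Permutation using (Permutation; permutation; _⟨$⟩ʳ_)
import Data.Fin.Properties as Finₚ
open import Data.Fin.Subset using (Subset; _∈_; ⊤)
open import Data.Fin.Subset.Properties using (_∈?_; ∈⊤)
open import Data.Integer.Base as ℤ using (ℤ; +_; -[1+_]; 0ℤ; 1ℤ; -1ℤ; _+_; _*_; _-_; -_)
  renaming (_^_ to infixr 8 _^ℤ_)
open import Data.Integer.DivMod using (_%ℕ_; n%ℕd<d; a≡a%ℕn+[a/ℕn]*n; _/ℕ_)
import Data.Integer.Divisibility.Signed as ∣ℤ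
open import Data.Integer.Divisibility.Signed using (divides) renaming (_∣_ to infix 4 _∣ℤ_)
import Data.Integer.Properties as ℤₚ
open import Data.Integer.Tactic.RingSolver using (solve-∀)
open import Data.Nat.Base as ℕ using (ℕ; zero; suc; NonZero; _%_; _^_)
open import Data.Nat.Coprimality as Coprime using (Coprime; coprime-Bézout; coprime-divisor)
open import Data.Nat.DivMod using (_mod_; m≡m%n+[m/n]*n; m%n<n; [m+kn]%n≡m%n)
open import Data.Nat.Divisibility using (_∣_)
import Data.Nat.Divisibility as ∣ℕ
import Data.Nat.GCD as GCD
open import Data.Nat.Induction using (<-rec)
open import Data.Nat.Primality
  using (Prime; prime; composite; prime?; prime⇒irreducible; prime⇒nonTrivial)
import Data.Nat.Properties as ℕₚ
import Data.Nat.Tactic.RingSolver as ℕ-Solver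
open import Data.Product.Base using (∃; ∃-syntax; ∃₂; _×_; _,_; proj₁; proj₂)
open import Data.Sum.Base as ⊎ using (_⊎_; inj₁; inj₂)
open import Data.Vec.Base as Vec using (Vec; []; _∷_)
open import Data.Vec.Properties using (lookup∘tabulate; []=⇒lookup; lookup⇒[]=)
open import Function.Base using (_∘_; case_of_)
open import Function.Bundles using (_⇔_; mk⇔)
open import Function.Definitions using (Injective)
open import Level using (0ℓ)
open import Relation.Binary.Bundles using (Setoid)
open import Relation.Binary.PropositionalEquality
  using (_≡_; _≢_; refl; cong; cong₂; subst; subst₂; sym; trans; module ≡-Reasoning)
import Relation.Binary.Reasoning.Setoid as SetoidReasoning
open import Relation.Nullary using (¬_; Dec; yes; no; contradiction; does)
open import Relation.Nullary.Decidable
  using (_×-dec_; _⊎-dec_; _→-dec_; ¬?; map′; dec-true; dec-false; from-yes; from-no; decidable-stable)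
open import Relation.Unary using (Pred; Decidable)

-- Congruences, units and squares

infix 4 _≈_[_]

-- A record rather than a synonym for the divisibility, so that `x`, `y` and `n` can be read off the
-- type of a congruence instead of being buried in `x - y`.
record _≈_[_] (x y : ℤ) (n : ℕ) : Set where
  constructor congruent
  field divisible : + n ∣ℤ x - y

open _≈_[_]

≈-reflexive : ∀ {n x y} → x ≡ y → x ≈ y [ n ]
≈-reflexive {n} {x} refl = congruent (divides 0ℤ (ℤₚ.+-inverseʳ x))

≈-refl : ∀ {n x} → x ≈ x [ n ]
≈-refl = ≈-reflexive refl

≈-sym : ∀ {n x y} → x ≈ y [ n ] → y ≈ x [ n ]
≈-sym {n} {x} {y} (congruent d) = congruent (subst (+ n ∣ℤ_) (eq x y) (∣ℤ.∣m⇒∣-m d))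
  where
  eq : ∀ x y → - (x - y) ≡ y - x
  eq = solve-∀

≈-trans : ∀ {n x y z} → x ≈ y [ n ] → y ≈ z [ n ] → x ≈ z [ n ]
≈-trans {n} {x} {y} {z} (congruent d) (congruent e) =
  congruent (subst (+ n ∣ℤ_) (eq x y z) (∣ℤ.∣m∣n⇒∣m+n d e))
  where
  eq : ∀ x y z → (x - y) + (y - z) ≡ x - z
  eq = solve-∀

≈-setoid : ℕ → Setoid 0ℓ 0ℓ
≈-setoid n = record
  { Carrier       = ℤ
  ; _≈_           = _≈_[ n ]
  ; isEquivalence = record { refl = ≈-refl ; sym = ≈-sym ; trans = ≈-trans }
  }

module ≈-Reasoning n = SetoidReasoning (≈-setoid n)

neg-cong : ∀ {n x y} → x ≈ y [ n ] → - x ≈ - y [ n ]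
neg-cong {n} {x} {y} (congruent d) = congruent (subst (+ n ∣ℤ_) (eq x y) (∣ℤ.∣m⇒∣-m d))
  where
  eq : ∀ x y → - (x - y) ≡ - x - - y
  eq = solve-∀

+-cong : ∀ {n x y u v} → x ≈ y [ n ] → u ≈ v [ n ] → x + u ≈ y + v [ n ]
+-cong {n} {x} {y} {u} {v} (congruent d) (congruent e) =
  congruent (subst (+ n ∣ℤ_) (eq x y u v) (∣ℤ.∣m∣n⇒∣m+n d e))
  where
  eq : ∀ x y u v → (x - y) + (u - v) ≡ (x + u) - (y + v)
  eq = solve-∀

-‿cong : ∀ {n x y u v} → x ≈ y [ n ] → u ≈ v [ n ] → x - u ≈ y - v [ n ]
-‿cong p q = +-cong p (neg-cong q)

*-cong : ∀ {n x y u v} → x ≈ y [ n ] → u ≈ v [ n ] → x * u ≈ y * v [ n ]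
*-cong {n} {x} {y} {u} {v} (congruent d) (congruent e) =
  congruent (subst (+ n ∣ℤ_) (eq x y u v) (∣ℤ.∣m∣n⇒∣m+n (∣ℤ.∣m⇒∣m*n u d) (∣ℤ.∣n⇒∣m*n y e)))
  where
  eq : ∀ x y u v → (x - y) * u + y * (u - v) ≡ x * u - y * v
  eq = solve-∀

^-cong : ∀ {n x y} k → x ≈ y [ n ] → x ^ℤ k ≈ y ^ℤ k [ n ]
^-cong zero    p = ≈-refl
^-cong (suc k) p = *-cong p (^-cong k p)

*-commutativeMonoid : ℕ → CommutativeMonoid 0ℓ 0ℓ
*-commutativeMonoid n = record
  { Carrier = ℤ ; _≈_ = _≈_[ n ] ; _∙_ = _*_ ; ε = 1ℤ
  ; isCommutativeMonoid = record
    { isMonoid = record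
      { isSemigroup = record
        { isMagma = record { isEquivalence = Setoid.isEquivalence (≈-setoid n) ; ∙-cong = *-cong }
        ; assoc = λ x y z → ≈-reflexive (ℤₚ.*-assoc x y z) }
      ; identity = (λ x → ≈-reflexive (ℤₚ.*-identityˡ x)) , (λ x → ≈-reflexive (ℤₚ.*-identityʳ x)) }
    ; comm = λ x y → ≈-reflexive (ℤₚ.*-comm x y) } }

≈-weaken : ∀ {m n x y} → + m ∣ℤ + n → x ≈ y [ n ] → x ≈ y [ m ]
≈-weaken m∣n (congruent d) = congruent (∣ℤ.∣-trans m∣n d)

≈0⇒∣ : ∀ {n x} → x ≈ 0ℤ [ n ] → + n ∣ℤ x
≈0⇒∣ {n} {x} (congruent d) = subst (+ n ∣ℤ_) (ℤₚ.+-identityʳ x) d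

∣⇒≈0 : ∀ {n x} → + n ∣ℤ x → x ≈ 0ℤ [ n ]
∣⇒≈0 {n} {x} d = congruent (subst (+ n ∣ℤ_) (sym (ℤₚ.+-identityʳ x)) d)

≈⇒-≈0 : ∀ {n x y} → x ≈ y [ n ] → x - y ≈ 0ℤ [ n ]
≈⇒-≈0 (congruent d) = ∣⇒≈0 d

-≈0⇒≈ : ∀ {n x y} → x - y ≈ 0ℤ [ n ] → x ≈ y [ n ]
-≈0⇒≈ p = congruent (≈0⇒∣ p)

record Unit[_] (n : ℕ) (u : ℤ) : Set where
  constructor unit
  field
    inverse  : ℤ
    inverseʳ : u * inverse ≈ 1ℤ [ n ]

record Square[_] (n : ℕ) (x : ℤ) : Set where
  constructor square
  field
    root     : ℤ
    isUnit   : Unit[ n ] root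
    isSquare : x ≈ root * root [ n ]

private
  interchange : ∀ u v i j → (u * v) * (i * j) ≡ (u * i) * (v * j)
  interchange = solve-∀

1-unit : ∀ {n} → Unit[ n ] 1ℤ
1-unit = unit 1ℤ ≈-refl

*-unit : ∀ {n u v} → Unit[ n ] u → Unit[ n ] v → Unit[ n ] (u * v)
*-unit {n} {u} {v} (unit i ui) (unit j vj) =
  unit (i * j) (≈-trans (≈-reflexive (interchange u v i j)) (*-cong ui vj))

unit-resp : ∀ {n u v} → u ≈ v [ n ] → Unit[ n ] u → Unit[ n ] v
unit-resp p (unit i ui) = unit i (≈-trans (*-cong (≈-sym p) ≈-refl) ui)

inverse-unit : ∀ {n u} (U : Unit[ n ] u) → Unit[ n ] (Unit[_].inverse U)
inverse-unit {u = u} (unit i p) = unit u (≈-trans (≈-reflexive (ℤₚ.*-comm i u)) p)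

neg-unit : ∀ {n u} → Unit[ n ] u → Unit[ n ] (- u)
neg-unit {n} {u} (unit i p) = unit (- i) (≈-trans (≈-reflexive (eq u i)) p)
  where
  eq : ∀ u i → - u * - i ≡ u * i
  eq = solve-∀

unit-cancelˡ : ∀ {n u x y} → Unit[ n ] u → u * x ≈ u * y [ n ] → x ≈ y [ n ]
unit-cancelˡ {n} {u} {x} {y} (unit i ui) p = begin
  x            ≡⟨ ℤₚ.*-identityˡ x ⟨
  1ℤ * x       ≈⟨ *-cong ui ≈-refl ⟨
  u * i * x    ≡⟨ eq u i x ⟩
  i * (u * x)  ≈⟨ *-cong (≈-refl {x = i}) p ⟩
  i * (u * y)  ≡⟨ eq u i y ⟨
  u * i * y    ≈⟨ *-cong ui ≈-refl ⟩
  1ℤ * y       ≡⟨ ℤₚ.*-identityˡ y ⟩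
  y            ∎
  where
  open ≈-Reasoning n
  eq : ∀ u i x → u * i * x ≡ i * (u * x)
  eq = solve-∀

unit-weaken : ∀ {m n u} → + m ∣ℤ + n → Unit[ n ] u → Unit[ m ] u
unit-weaken m∣n (unit i p) = unit i (≈-weaken m∣n p)

square-weaken : ∀ {m n x} → + m ∣ℤ + n → Square[ n ] x → Square[ m ] x
square-weaken m∣n (square u U p) = square u (unit-weaken m∣n U) (≈-weaken m∣n p)

square-resp : ∀ {n x y} → x ≈ y [ n ] → Square[ n ] x → Square[ n ] y
square-resp p (square u U q) = square u U (≈-trans (≈-sym p) q)

square⇒unit : ∀ {n x} → Square[ n ] x → Unit[ n ] x
square⇒unit (square u U p) = unit-resp (≈-sym p) (*-unit U U)

unit⇒square : ∀ {n u} → Unit[ n ] u → Square[ n ] (u * u)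
unit⇒square {u = u} U = square u U ≈-refl

1-square : ∀ {n} → Square[ n ] 1ℤ
1-square = unit⇒square 1-unit

*-square : ∀ {n x y} → Square[ n ] x → Square[ n ] y → Square[ n ] (x * y)
*-square {n} (square u U p) (square v V q) =
  square (u * v) (*-unit U V) (≈-trans (*-cong p q) (≈-reflexive (interchange u u v v)))

-- If `i` inverts the root `u` of `x`, then `i * i` is a square that inverts `x`, which makes `y` a
-- product of two squares modulo `n`.
square-cancelˡ : ∀ {n x y} → Square[ n ] x → Square[ n ] (x * y) → Square[ n ] y
square-cancelˡ {n} {x} {y} (square u U@(unit i ui) p) s =
  square-resp eq (*-square (unit⇒square (inverse-unit U)) s)
  where
  open ≈-Reasoning n
  rearrange : ∀ u i y → i * i * (u * u * y) ≡ (u * i) * (u * i) * y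
  rearrange = solve-∀
  eq : i * i * (x * y) ≈ y [ n ]
  eq = begin
    i * i * (x * y)          ≈⟨ *-cong (≈-refl {x = i * i}) (*-cong p ≈-refl) ⟩
    i * i * (u * u * y)      ≡⟨ rearrange u i y ⟩
    (u * i) * (u * i) * y    ≈⟨ *-cong (*-cong ui ui) ≈-refl ⟩
    1ℤ * y                   ≡⟨ ℤₚ.*-identityˡ y ⟩
    y                        ∎

-- Arithmetic modulo a prime

infix 4 _≈?_[_]

_≈?_[_] : ∀ x y n → Dec (x ≈ y [ n ])
x ≈? y [ n ] = map′ congruent _≈_[_].divisible (+ n ∣ℤ.∣? (x - y))

∣ℕ⇒∣ : ∀ {m n} → m ∣ n → + m ∣ℤ + n
∣ℕ⇒∣ = ∣ℤ.∣ᵤ⇒∣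

≈0⇒∣ℕ : ∀ {n m} → + m ≈ 0ℤ [ n ] → n ∣ m
≈0⇒∣ℕ p = ∣ℤ.∣⇒∣ᵤ (≈0⇒∣ p)

∣ℕ⇒≈0 : ∀ {n m} → n ∣ m → + m ≈ 0ℤ [ n ]
∣ℕ⇒≈0 d = ∣⇒≈0 (∣ℕ⇒∣ d)

positive-≉0 : ∀ {n i} .{{_ : NonZero i}} → i ℕ.< n → ¬ (+ i ≈ 0ℤ [ n ])
positive-≉0 i<n p = ℕₚ.<⇒≱ i<n (∣ℕ.∣⇒≤ (≈0⇒∣ℕ p))

-- The distance between `i` and `j` is a multiple of `n` smaller than `n`.
≈⇒≡ : ∀ {n i j} → i ℕ.< n → j ℕ.< n → + i ≈ + j [ n ] → i ≡ j
≈⇒≡ {n} {i} {j} i<n j<n (congruent d) with ℤ.∣ + i - + j ∣ in eq | ∣ℤ.∣⇒∣ᵤ d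
... | zero  | _ = ℤₚ.+-injective (ℤₚ.i-j≡0⇒i≡j (+ i) (+ j) (ℤₚ.∣i∣≡0⇒i≡0 eq))
... | suc k | n∣k = contradiction (∣ℕ.∣⇒≤ n∣k) (ℕₚ.<⇒≱ (begin-strict
    suc k                 ≡⟨ eq ⟨
    ℤ.∣ + i - + j ∣       ≡⟨ cong ℤ.∣_∣ (ℤₚ.[+m]-[+n]≡m⊖n i j) ⟩
    ℤ.∣ i ℤ.⊖ j ∣         ≤⟨ ℤₚ.∣m⊝n∣≤m⊔n i j ⟩
    i ℕ.⊔ j               <⟨ ℕₚ.⊔-lub i<n j<n ⟩
    n                     ∎))
  where open ℕₚ.≤-Reasoning

residue : ∀ n .{{_ : NonZero n}} → ℤ → Fin n
residue n x = fromℕ< (n%ℕd<d x n)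

residue-≈ : ∀ {n} .{{_ : NonZero n}} x → + toℕ (residue n x) ≈ x [ n ]
residue-≈ {n} x = ≈-sym (congruent (divides (x /ℕ n) (begin
  x - + toℕ (residue n x)                        ≡⟨ cong (λ r → x - + r) (Finₚ.toℕ-fromℕ< _) ⟩
  x - + (x %ℕ n)                                 ≡⟨ cong (λ z → z - + (x %ℕ n)) (a≡a%ℕn+[a/ℕn]*n x n) ⟩
  + (x %ℕ n) + (x /ℕ n) * + n - + (x %ℕ n)       ≡⟨ eq (+ (x %ℕ n)) ((x /ℕ n) * + n) ⟩
  (x /ℕ n) * + n                                 ∎)))
  where
  open ≡-Reasoning
  eq : ∀ a b → a + b - a ≡ b
  eq = solve-∀

toℕ-≈-injective : ∀ {n} {i j : Fin n} → + toℕ i ≈ + toℕ j [ n ] → i ≡ j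
toℕ-≈-injective {i = i} {j} p = Finₚ.toℕ-injective (≈⇒≡ (Finₚ.toℕ<n i) (Finₚ.toℕ<n j) p)

residue-toℕ : ∀ {n} .{{_ : NonZero n}} {x} {i : Fin n} → x ≈ + toℕ i [ n ] → residue n x ≡ i
residue-toℕ {x = x} p = toℕ-≈-injective (≈-trans (residue-≈ x) p)

bézout : ∀ {m n} → Coprime m n → ∃₂ λ s t → + m * s + + n * t ≡ 1ℤ
bézout {m} {n} c with coprime-Bézout c
... | GCD.Bézout.+- x y eq = + x , - + y , (begin
  + m * + x + + n * - + y        ≡⟨ cong (λ z → z + + n * - + y) (trans (ℤₚ.*-comm (+ m) (+ x)) (trans (sym (ℤₚ.pos-* x m)) (cong +_ (sym eq)))) ⟩
  + (1 ℕ.+ y ℕ.* n) + + n * - + y ≡⟨ cong (λ z → 1ℤ + z + + n * - + y) (ℤₚ.pos-* y n) ⟩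
  1ℤ + + y * + n + + n * - + y    ≡⟨ lemma (+ y) (+ n) ⟩
  1ℤ                              ∎)
  where
  open ≡-Reasoning
  lemma : ∀ y n → 1ℤ + y * n + n * - y ≡ 1ℤ
  lemma = solve-∀
... | GCD.Bézout.-+ x y eq = - + x , + y , (begin
  + m * - + x + + n * + y         ≡⟨ cong (λ z → + m * - + x + z) (trans (ℤₚ.*-comm (+ n) (+ y)) (trans (sym (ℤₚ.pos-* y n)) (cong +_ (sym eq)))) ⟩
  + m * - + x + + (1 ℕ.+ x ℕ.* m) ≡⟨ cong (λ z → + m * - + x + (1ℤ + z)) (ℤₚ.pos-* x m) ⟩
  + m * - + x + (1ℤ + + x * + m)  ≡⟨ lemma (+ x) (+ m) ⟩
  1ℤ                              ∎)
  where
  open ≡-Reasoning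
  lemma : ∀ x m → m * - x + (1ℤ + x * m) ≡ 1ℤ
  lemma = solve-∀

coprime⇒unit : ∀ {m n} → Coprime m n → Unit[ n ] (+ m)
coprime⇒unit {m} {n} c with bézout c
... | s , t , eq = unit s (congruent (divides (- t) (begin
  + m * s - 1ℤ                     ≡⟨ cong (λ z → + m * s - z) eq ⟨
  + m * s - (+ m * s + + n * t)    ≡⟨ lemma (+ m * s) (+ n) t ⟩
  - t * + n                        ∎)))
  where
  open ≡-Reasoning
  lemma : ∀ a n t → a - (a + n * t) ≡ - t * n
  lemma = solve-∀

unit-∣∣ : ∀ {n} x → Unit[ n ] (+ ℤ.∣ x ∣) → Unit[ n ] x
unit-∣∣ (+ m)    U = U
unit-∣∣ -[1+ m ] U = neg-unit U

-- Modulo `d` the relation `x * i ≈ 1ℤ` becomes 0 ≈ 1. This is how differences of adjacent vertices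
-- are seen not to vanish modulo a divisor of `n`.
unit-∣⇒≡1 : ∀ {d n x} → Unit[ n ] x → + d ∣ℤ + n → + d ∣ℤ x → d ≡ 1
unit-∣⇒≡1 {d} {n} {x} (unit i p) d∣n d∣x = ∣ℕ.∣1⇒≡1 (≈0⇒∣ℕ (begin
  1ℤ      ≈⟨ ≈-weaken d∣n p ⟨
  x * i   ≈⟨ *-cong (∣⇒≈0 d∣x) (≈-refl {x = i}) ⟩
  0ℤ * i  ≡⟨ ℤₚ.*-zeroˡ i ⟩
  0ℤ      ∎))
  where open ≈-Reasoning d

module _ {p} (p-prime : Prime p) where

  prime≢1 : p ≢ 1
  prime≢1 p≡1 = ℕ.nonTrivial⇒≢1 {{prime⇒nonTrivial p-prime}} p≡1

  ∤⇒coprime : ∀ {m} → ¬ (p ∣ m) → Coprime m p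
  ∤⇒coprime p∤m (d∣m , d∣p) with prime⇒irreducible p-prime d∣p
  ... | inj₁ d≡1  = d≡1
  ... | inj₂ refl = contradiction d∣m p∤m

  ≉0⇒unit : ∀ {x} → ¬ (x ≈ 0ℤ [ p ]) → Unit[ p ] x
  ≉0⇒unit {x} x≉0 = unit-∣∣ x (coprime⇒unit (∤⇒coprime (λ p∣x → x≉0 (∣⇒≈0 (∣ℤ.∣ᵤ⇒∣ p∣x)))))

  unit⇒≉0 : ∀ {x} → Unit[ p ] x → ¬ (x ≈ 0ℤ [ p ])
  unit⇒≉0 U x≈0 = prime≢1 (unit-∣⇒≡1 U ∣ℤ.∣-refl (≈0⇒∣ x≈0))

  *≈0 : ∀ x y → x * y ≈ 0ℤ [ p ] → x ≈ 0ℤ [ p ] ⊎ y ≈ 0ℤ [ p ]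
  *≈0 x y xy≈0 with x ≈? 0ℤ [ p ]
  ... | yes x≈0 = inj₁ x≈0
  ... | no  x≉0 = inj₂ (unit-cancelˡ (≉0⇒unit x≉0) (≈-trans xy≈0 (≈-reflexive (sym (ℤₚ.*-zeroʳ x)))))

∏-const : ∀ n r x → Sum.sum (*-commutativeMonoid n) {r} (λ _ → x) ≡ x ^ℤ r
∏-const n zero    x = refl
∏-const n (suc r) x = cong (x *_) (∏-const n r x)

-- Multiplication by x permutes the nonzero residues, so it multiplies their
-- product by x ^ℤ r; the residue 0 is given the neutral weight 1.
fermat : ∀ {r x} → Prime (suc r) → ¬ (x ≈ 0ℤ [ suc r ]) → x ^ℤ r ≈ 1ℤ [ suc r ]
fermat {r} {x} p-prime x≉0 = unit-cancelˡ {u = ∏ g} ∏g-unit (begin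
  ∏ g * x ^ℤ r          ≡⟨ cong (λ z → ∏ g * z) (∏-const (suc r) r x) ⟨
  ∏ g * ∏ {r} (λ _ → x)    ≡⟨ rearrange (∏ g) (∏ {r} (λ _ → x)) ⟩
  ∏ h * ∏ g            ≈⟨ ∑-distrib-+ h g ⟨
  ∏ (λ i → h i * g i)  ≈⟨ sum-cong-≋ (λ i → g-π i) ⟨
  ∏ (λ i → g (π ⟨$⟩ʳ i)) ≈⟨ sum-permute g π ⟨
  ∏ g                  ≡⟨ ℤₚ.*-identityʳ (∏ g) ⟨
  ∏ g * 1ℤ             ∎)
  where
  open ≈-Reasoning (suc r)
  open Sum (*-commutativeMonoid (suc r)) using (sum-permute; sum-cong-≋; ∑-distrib-+) renaming (sum to ∏)
  U = ≉0⇒unit p-prime x≉0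
  y = Unit[_].inverse U

  rearrange : ∀ a b → a * b ≡ 1ℤ * b * a
  rearrange = solve-∀

  g h : Fin (suc r) → ℤ
  g zero    = 1ℤ
  g (suc i) = + suc (toℕ i)
  h zero    = 1ℤ
  h (suc i) = x

  scale : ∀ u v → u * v ≈ 1ℤ [ suc r ] → ∀ i →
          residue (suc r) (u * + toℕ (residue (suc r) (v * + toℕ i))) ≡ i
  scale u v uv i = residue-toℕ (begin
    u * + toℕ (residue (suc r) (v * + toℕ i)) ≈⟨ *-cong (≈-refl {x = u}) (residue-≈ _) ⟩
    u * (v * + toℕ i)                         ≡⟨ ℤₚ.*-assoc u v _ ⟨
    u * v * + toℕ i                           ≈⟨ *-cong uv ≈-refl ⟩
    1ℤ * + toℕ i                              ≡⟨ ℤₚ.*-identityˡ _ ⟩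
    + toℕ i                                   ∎)

  π : Permutation (suc r) (suc r)
  π = permutation (λ i → residue (suc r) (x * + toℕ i)) (λ i → residue (suc r) (y * + toℕ i))
        (scale x y (Unit[_].inverseʳ U))
        (scale y x (≈-trans (≈-reflexive (ℤₚ.*-comm y x)) (Unit[_].inverseʳ U)))

  g-nonzero : ∀ j → ¬ (+ toℕ j ≈ 0ℤ [ suc r ]) → g j ≡ + toℕ j
  g-nonzero zero    j≉0 = contradiction ≈-refl j≉0
  g-nonzero (suc j) _   = refl

  suc≉0 : ∀ (i : Fin r) → ¬ (+ suc (toℕ i) ≈ 0ℤ [ suc r ])
  suc≉0 i = positive-≉0 (ℕ.s≤s (Finₚ.toℕ<n i))

  g-π : ∀ i → g (π ⟨$⟩ʳ i) ≈ h i * g i [ suc r ]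
  g-π zero = ≈-reflexive (cong g (residue-toℕ {i = zero} (≈-reflexive (ℤₚ.*-zeroʳ x))))
  g-π (suc i) = begin
    g (residue (suc r) xi)        ≡⟨ g-nonzero (residue (suc r) xi) (λ q → xi≉0 (≈-trans (≈-sym (residue-≈ xi)) q)) ⟩
    + toℕ (residue (suc r) xi)    ≈⟨ residue-≈ xi ⟩
    xi                            ∎
    where
    xi = x * + suc (toℕ i)
    xi≉0 : ¬ (xi ≈ 0ℤ [ suc r ])
    xi≉0 q with *≈0 p-prime x (+ suc (toℕ i)) q
    ... | inj₁ x≈0 = x≉0 x≈0
    ... | inj₂ i≈0 = suc≉0 i i≈0

  ∏-unit : ∀ {n} (f : Fin n → ℤ) → (∀ i → Unit[ suc r ] (f i)) → Unit[ suc r ] (∏ f)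
  ∏-unit {zero}  f _ = 1-unit
  ∏-unit {suc n} f F = *-unit (F zero) (∏-unit (f ∘ suc) (F ∘ suc))

  g-unit : ∀ i → Unit[ suc r ] (g i)
  g-unit zero    = 1-unit
  g-unit (suc i) = ≉0⇒unit p-prime (suc≉0 i)

  ∏g-unit = ∏-unit g g-unit

-- The monic polynomial with the listed lower coefficients, constant term first.
eval : ∀ {d} → Vec ℤ d → ℤ → ℤ
eval []       x = 1ℤ
eval (c ∷ cs) x = x * eval cs x + c

-- Synthetic division by X - `a`: the coefficients of the quotient are the intermediate values of
-- Horner's scheme at `a`.
quotient : ∀ {d} → ℤ → Vec ℤ (suc d) → Vec ℤ d
quotient a (c ∷ [])         = []
quotient a (c ∷ cs@(_ ∷ _)) = eval cs a ∷ quotient a cs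

eval-quotient : ∀ {d} a x (cs : Vec ℤ (suc d)) → eval cs x ≡ (x - a) * eval (quotient a cs) x + eval cs a
eval-quotient a x (c ∷ [])         = lemma a x c
  where
  lemma : ∀ a x c → x * 1ℤ + c ≡ (x - a) * 1ℤ + (a * 1ℤ + c)
  lemma = solve-∀
eval-quotient a x (c ∷ cs@(_ ∷ _)) =
  trans (cong (λ e → x * e + c) (eval-quotient a x cs)) (lemma a x c (eval (quotient a cs) x) (eval cs a))
  where
  lemma : ∀ a x c e f → x * ((x - a) * e + f) + c ≡ (x - a) * (x * e + f) + (a * f + c)
  lemma = solve-∀

-- Lagrange's bound, by induction on the degree: dividing by X minus the first root leaves a
-- quotient that vanishes at the other roots, since their differences from the first are nonzero
-- modulo the prime.
root-bound : ∀ {p d} → Prime p → (cs : Vec ℤ d) (r : Fin (suc d) → ℤ) →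
             (∀ i j → r i ≈ r j [ p ] → i ≡ j) → ¬ (∀ i → eval cs (r i) ≈ 0ℤ [ p ])
root-bound p-prime [] r inj zeros = unit⇒≉0 p-prime 1-unit (zeros zero)
root-bound {p} p-prime cs@(_ ∷ _) r inj zeros = root-bound p-prime (quotient a cs) (r ∘ suc)
  (λ i j e → Finₚ.suc-injective (inj (suc i) (suc j) e)) zeros′
  where
  open ≈-Reasoning p
  a = r zero
  lemma : ∀ x y → x ≡ x + y - y
  lemma = solve-∀
  zeros′ : ∀ i → eval (quotient a cs) (r (suc i)) ≈ 0ℤ [ p ]
  zeros′ i with *≈0 p-prime (r (suc i) - a) (eval (quotient a cs) (r (suc i))) (begin
      (r (suc i) - a) * eval (quotient a cs) (r (suc i))  ≡⟨ lemma _ (eval cs a) ⟩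
      (r (suc i) - a) * eval (quotient a cs) (r (suc i)) + eval cs a - eval cs a
        ≡⟨ cong (λ z → z - eval cs a) (eval-quotient a (r (suc i)) cs) ⟨
      eval cs (r (suc i)) - eval cs a  ≈⟨ -‿cong (zeros (suc i)) (zeros zero) ⟩
      0ℤ                               ∎)
  ... | inj₂ q = q
  ... | inj₁ q with () ← inj (suc i) zero (-≈0⇒≈ q)

-- The coefficient list spells X^(h+1) - 1, whose degree is one less than the number of roots
-- supplied.
unity-root-bound : ∀ {p h} → Prime p → (r : Fin (suc (suc h)) → ℤ) →
                   (∀ i j → r i ≈ r j [ p ] → i ≡ j) → ¬ (∀ i → r i ^ℤ suc h ≈ 1ℤ [ p ])
unity-root-bound {p} {h} p-prime r inj roots = root-bound p-prime (-1ℤ ∷ Vec.replicate h 0ℤ) r inj λ i →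
  ≈-trans (≈-reflexive (cong (λ e → r i * e + -1ℤ) (eval-zeros h (r i)))) (≈⇒-≈0 (roots i))
  where
  eval-zeros : ∀ h x → eval (Vec.replicate h 0ℤ) x ≡ x ^ℤ h
  eval-zeros zero    x = refl
  eval-zeros (suc h) x = trans (ℤₚ.+-identityʳ _) (cong (x *_) (eval-zeros h x))

-- Squares modulo prime powers

square-^ : ∀ u h → (u * u) ^ℤ h ≡ u ^ℤ (h ℕ.* 2)
square-^ u zero    = refl
square-^ u (suc h) = trans (ℤₚ.*-assoc u u _) (cong (λ z → u * (u * z)) (square-^ u h))

neg-^-even : ∀ x h → (- x) ^ℤ (h ℕ.* 2) ≡ x ^ℤ (h ℕ.* 2)
neg-^-even x h = trans (sym (square-^ (- x) h)) (trans (cong (_^ℤ h) (neg-square x)) (square-^ x h))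
  where
  neg-square : ∀ x → - x * - x ≡ x * x
  neg-square = solve-∀

neg-^-odd : ∀ x h → (- x) ^ℤ suc (h ℕ.* 2) ≡ - (x ^ℤ suc (h ℕ.* 2))
neg-^-odd x h = trans (cong (- x *_) (neg-^-even x h)) (sym (ℤₚ.neg-distribˡ-* x _))

module _ h (p-prime : Prime (suc (h ℕ.* 2))) where
  private
    p : ℕ
    p = suc (h ℕ.* 2)

  -- By Fermat the `h`-th power of `x` squares to 1, and modulo a prime its two possible values come
  -- from the factors of z² - 1.
  half-power : ∀ {x} → ¬ (x ≈ 0ℤ [ p ]) → x ^ℤ h ≈ 1ℤ [ p ] ⊎ x ^ℤ h ≈ -1ℤ [ p ]
  half-power {x} x≉0 = ⊎.map -≈0⇒≈ -≈0⇒≈ (*≈0 p-prime (x ^ℤ h - 1ℤ) (x ^ℤ h - -1ℤ) (begin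
    (x ^ℤ h - 1ℤ) * (x ^ℤ h - -1ℤ)  ≡⟨ lemma (x ^ℤ h) ⟩
    x ^ℤ h * x ^ℤ h - 1ℤ            ≡⟨ cong (λ z → z - 1ℤ) (ℤₚ.^-distribˡ-+-* x h h) ⟨
    x ^ℤ (h ℕ.+ h) - 1ℤ            ≡⟨ cong (λ z → x ^ℤ z - 1ℤ) (double h) ⟩
    x ^ℤ (h ℕ.* 2) - 1ℤ            ≈⟨ ≈⇒-≈0 (fermat p-prime x≉0) ⟩
    0ℤ                            ∎))
    where
    open ≈-Reasoning p
    lemma : ∀ z → (z - 1ℤ) * (z - -1ℤ) ≡ z * z - 1ℤ
    lemma = solve-∀
    double : ∀ h → h ℕ.+ h ≡ h ℕ.* 2
    double = ℕ-Solver.solve-∀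

  square⇒half-power : ∀ {x} → Square[ p ] x → x ^ℤ h ≈ 1ℤ [ p ]
  square⇒half-power {x} (square u U x≈u²) = begin
    x ^ℤ h          ≈⟨ ^-cong h x≈u² ⟩
    (u * u) ^ℤ h    ≡⟨ square-^ u h ⟩
    u ^ℤ (h ℕ.* 2)  ≈⟨ fermat p-prime (unit⇒≉0 p-prime U) ⟩
    1ℤ             ∎
    where open ≈-Reasoning p

-- The sum 1 + z + ... + z^(k-1) in Horner form.
geometric : ℕ → ℤ → ℤ
geometric zero    z = 0ℤ
geometric (suc k) z = z * geometric k z + 1ℤ

^-minus-1 : ∀ k z → z ^ℤ k - 1ℤ ≡ (z - 1ℤ) * geometric k z
^-minus-1 zero    z = sym (ℤₚ.*-zeroʳ (z - 1ℤ))
^-minus-1 (suc k) z = begin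
  z * z ^ℤ k - 1ℤ                                ≡⟨ lemma₁ z (z ^ℤ k) ⟩
  z * (z ^ℤ k - 1ℤ) + (z - 1ℤ)                   ≡⟨ cong (λ e → z * e + (z - 1ℤ)) (^-minus-1 k z) ⟩
  z * ((z - 1ℤ) * geometric k z) + (z - 1ℤ)     ≡⟨ lemma₂ z (geometric k z) ⟩
  (z - 1ℤ) * (z * geometric k z + 1ℤ)           ∎
  where
  open ≡-Reasoning
  lemma₁ : ∀ z y → z * y - 1ℤ ≡ z * (y - 1ℤ) + (z - 1ℤ)
  lemma₁ = solve-∀
  lemma₂ : ∀ z y → z * ((z - 1ℤ) * y) + (z - 1ℤ) ≡ (z - 1ℤ) * (z * y + 1ℤ)
  lemma₂ = solve-∀

geometric-≈ : ∀ {n z} k → z ≈ 1ℤ [ n ] → geometric k z ≈ + k [ n ]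
geometric-≈ zero    z≈1 = ≈-refl
geometric-≈ {n} {z} (suc k) z≈1 = begin
  z * geometric k z + 1ℤ  ≈⟨ +-cong (*-cong z≈1 (geometric-≈ k z≈1)) (≈-refl {x = 1ℤ}) ⟩
  1ℤ * + k + 1ℤ           ≡⟨ cong (λ e → e + 1ℤ) (ℤₚ.*-identityˡ (+ k)) ⟩
  + k + 1ℤ                ≡⟨ ℤₚ.+-comm (+ k) 1ℤ ⟩
  + suc k                 ∎
  where open ≈-Reasoning n

*-∣-* : ∀ {m n x y} → + m ∣ℤ x → + n ∣ℤ y → + (m ℕ.* n) ∣ℤ x * y
*-∣-* {m} {n} {x} {y} (divides k x≡km) (divides l y≡ln) = divides (k * l) (begin
  x * y                    ≡⟨ cong₂ _*_ x≡km y≡ln ⟩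
  (k * + m) * (l * + n)    ≡⟨ lemma k l (+ m) (+ n) ⟩
  k * l * (+ m * + n)      ≡⟨ cong (k * l *_) (ℤₚ.pos-* m n) ⟨
  k * l * + (m ℕ.* n)      ∎)
  where
  open ≡-Reasoning
  lemma : ∀ k l m n → (k * m) * (l * n) ≡ k * l * (m * n)
  lemma = solve-∀

-- In z^p - 1 = (z - 1)(1 + z + ... + z^(p-1)) the first factor is divisible by `n`. The second is
-- congruent to `p`, hence to 0, modulo `p`, because each of its `p` terms is 1 there.
^-lift : ∀ {n p z} → z ≈ 1ℤ [ p ] → z ≈ 1ℤ [ n ] → z ^ℤ p ≈ 1ℤ [ p ℕ.* n ]
^-lift {n} {p} {z} z≈1[p] z≈1 = congruent (subst (_∣ℤ (z ^ℤ p - 1ℤ)) (cong +_ (ℕₚ.*-comm n p))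
  (subst (+ (n ℕ.* p) ∣ℤ_) (sym (^-minus-1 p z))
    (*-∣-* {n} {p} (_≈_[_].divisible z≈1) (≈0⇒∣ (≈-trans (geometric-≈ p z≈1[p]) (∣⇒≈0 ∣ℤ.∣-refl))))))

^-lifts : ∀ {p z} a → z ≈ 1ℤ [ p ] → z ^ℤ (p ^ a) ≈ 1ℤ [ p ^ suc a ]
^-lifts {p} {z} zero z≈1 = ≈-trans (≈-reflexive (ℤₚ.*-identityʳ z))
  (subst (z ≈ 1ℤ [_]) (sym (ℕₚ.*-identityʳ p)) z≈1)
^-lifts {p} {z} (suc a) z≈1 = subst (_≈ 1ℤ [ p ^ suc (suc a) ])
  (trans (ℤₚ.^-*-assoc z (p ^ a) p) (cong (z ^ℤ_) (ℕₚ.*-comm (p ^ a) p)))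
  (^-lift {p = p} (≈-weaken (∣ℕ⇒∣ (∣ℕ.m∣m*n (p ^ a))) ih) ih)
  where
  ih = ^-lifts a z≈1

Odd : ℕ → Set
Odd n = ∃[ k ] n ≡ suc (k ℕ.* 2)

odd-* : ∀ {m n} → Odd m → Odd n → Odd (m ℕ.* n)
odd-* (j , refl) (k , refl) = j ℕ.* 2 ℕ.* k ℕ.+ j ℕ.+ k , lemma j k
  where
  lemma : ∀ j k → suc (j ℕ.* 2) ℕ.* suc (k ℕ.* 2) ≡ suc ((j ℕ.* 2 ℕ.* k ℕ.+ j ℕ.+ k) ℕ.* 2)
  lemma = ℕ-Solver.solve-∀

odd-^ : ∀ {m} a → Odd m → Odd (m ^ a)
odd-^ zero    o = 0 , refl
odd-^ (suc a) o = odd-* o (odd-^ a o)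

-- With m = 2k + 1, x = x^(m+1) = (x^(k+1))².
odd-order⇒square : ∀ {n x m} → Odd m → x ^ℤ m ≈ 1ℤ [ n ] → Square[ n ] x
odd-order⇒square {n} {x} (k , refl) xᵐ≈1 = square (x ^ℤ suc k)
  (power-unit (suc k)) (begin
  x                        ≡⟨ ℤₚ.*-identityʳ x ⟨
  x * 1ℤ                   ≈⟨ *-cong (≈-refl {x = x}) xᵐ≈1 ⟨
  x * x ^ℤ suc (k ℕ.* 2)    ≡⟨ square-^ x (suc k) ⟨
  (x * x) ^ℤ suc k          ≡⟨ distrib (suc k) ⟩
  x ^ℤ suc k * x ^ℤ suc k    ∎)
  where
  open ≈-Reasoning n
  lemma : ∀ x y → x * x * (y * y) ≡ x * y * (x * y)
  lemma = solve-∀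
  distrib : ∀ k → (x * x) ^ℤ k ≡ x ^ℤ k * x ^ℤ k
  distrib zero    = refl
  distrib (suc k) = trans (cong (x * x *_) (distrib k)) (lemma x (x ^ℤ k))
  x-unit : Unit[ n ] x
  x-unit = unit (x ^ℤ (k ℕ.* 2)) xᵐ≈1
  power-unit : ∀ k → Unit[ n ] (x ^ℤ k)
  power-unit zero    = 1-unit
  power-unit (suc k) = *-unit x-unit (power-unit k)

-- The prime is 4k + 3, written so that h = (p - 1)/2 is odd by its form.
module _ k (p-prime : Prime (suc (suc (k ℕ.* 2) ℕ.* 2))) where
  private
    h p : ℕ
    h = suc (k ℕ.* 2)
    p = suc (h ℕ.* 2)

  -- As `h` is odd, the `h`-th power of -1 is -1, whereas that of a square is 1; then `p` would
  -- divide 2.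
  -1-nonsquare : ¬ Square[ p ] -1ℤ
  -1-nonsquare s = positive-≉0 {p} {2} (ℕ.s≤s (ℕ.s≤s (ℕ.s≤s ℕ.z≤n))) (begin
    1ℤ - -1ℤ          ≡⟨ cong (λ z → 1ℤ - - z) (ℤₚ.^-zeroˡ h) ⟨
    1ℤ - - (1ℤ ^ℤ h)   ≡⟨ cong (λ z → 1ℤ - z) (neg-^-odd 1ℤ k) ⟨
    1ℤ - -1ℤ ^ℤ h      ≈⟨ -‿cong (≈-refl {x = 1ℤ}) (square⇒half-power h p-prime s) ⟩
    0ℤ                ∎)
    where open ≈-Reasoning p

  -- Since `h` is odd, passing from `x` to `- x` turns the `h`-th power -1 into 1. If the `h`-th
  -- power is 1 modulo `p`, raising it further to the power p^a gives 1 modulo p^(a+1), and the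
  -- total exponent h p^a is odd.
  signed-square : ∀ {x} a → ¬ (x ≈ 0ℤ [ p ]) → Square[ p ^ suc a ] x ⊎ Square[ p ^ suc a ] (- x)
  signed-square {x} a x≉0 = ⊎.map (lift x) (λ e → lift (- x) (flip e)) (half-power h p-prime x≉0)
    where
    open ≈-Reasoning p
    lift : ∀ x → x ^ℤ h ≈ 1ℤ [ p ] → Square[ p ^ suc a ] x
    lift x xʰ≈1 = odd-order⇒square (odd-* (k , refl) (odd-^ a (h , refl)))
      (subst (_≈ 1ℤ [ p ^ suc a ]) (ℤₚ.^-*-assoc x h (p ^ a)) (^-lifts a xʰ≈1))
    flip : x ^ℤ h ≈ -1ℤ [ p ] → (- x) ^ℤ h ≈ 1ℤ [ p ]
    flip e = begin
      (- x) ^ℤ h    ≡⟨ neg-^-odd x k ⟩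
      - (x ^ℤ h)    ≈⟨ neg-cong e ⟩
      1ℤ           ∎

-- Perfect graphs

clique≤colouring : ∀ {V : Set} (G : Graph V) {j k} → Clique G j → Colouring G k → j ℕ.≤ k
clique≤colouring G (f , adj) (c , proper) = Finₚ.injective⇒≤ {f = c ∘ f} λ {x} {y} cfx≡cfy →
  decidable-stable (x Finₚ.≟ y) λ x≢y → proper (f x) (f y) (adj x y x≢y) cfx≡cfy

-- A clique and a colouring of the same size certify each other's optimality.
clique+colouring⇒perfect : ∀ {n} (G : Graph (Fin n)) →
  (∀ S → ∃[ k ] Clique (induced G S) k × Colouring (induced G S) k) → Perfect G
clique+colouring⇒perfect G both S with k , clique , colouring ← both S =
  k , (clique , λ j c → clique≤colouring (induced G S) c colouring)
    , (colouring , λ j c → clique≤colouring (induced G S) clique c)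

-- A transversal of the classes of `c` that meet `P`. In a complete multipartite graph its members
-- form a clique, and their indices serve as colours.
record Representatives {n} (P : Pred (Fin n) 0ℓ) (c : Fin n → ℕ) : Set where
  field
    size     : ℕ
    rep      : Fin size → ∃ P
    distinct : ∀ i j → i ≢ j → c (proj₁ (rep i)) ≢ c (proj₁ (rep j))
    cover    : ∀ x → P x → ∃[ i ] c (proj₁ (rep i)) ≡ c x

representatives : ∀ {n} {P : Pred (Fin n) 0ℓ} → Decidable P → (c : Fin n → ℕ) → Representatives P c
representatives {zero} P? c = record { size = 0 ; rep = λ () ; distinct = λ () ; cover = λ () }
representatives {suc n} {P} P? c = extend (P? zero)
  where
  open Representatives (representatives (P? ∘ suc) (c ∘ suc))
  rep′ : Fin size → ∃ P
  rep′ i = suc (proj₁ (rep i)) , proj₂ (rep i)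

  keep : (P zero → ∃[ i ] c (proj₁ (rep′ i)) ≡ c zero) → Representatives P c
  keep cover₀ = record { size = size ; rep = rep′ ; distinct = distinct
    ; cover = λ { zero → cover₀ ; (suc x) → cover x } }

  extend : Dec (P zero) → Representatives P c
  extend (no ¬p) = keep (λ p → contradiction p ¬p)
  extend (yes p) with Finₚ.any? (λ i → c (proj₁ (rep′ i)) ℕₚ.≟ c zero)
  ... | yes covered = keep (λ _ → covered)
  ... | no  new     = record
    { size     = suc size
    ; rep      = λ { zero → zero , p ; (suc i) → rep′ i }
    ; distinct = λ { zero    zero    0≢0 → contradiction refl 0≢0
                   ; zero    (suc j) _   e → new (j , sym e)
                   ; (suc i) zero    _   e → new (i , e)
                   ; (suc i) (suc j) i≢j → distinct i j (i≢j ∘ cong suc) }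
    ; cover    = λ { zero _ → zero , refl ; (suc x) q → case cover x q of λ (i , e) → suc i , e }
    }

multipartite⇒perfect : ∀ {n} (G : Graph (Fin n)) (c : Fin n → ℕ) →
  (∀ u v → Graph.Adj G u v → c u ≢ c v) → (∀ u v → c u ≢ c v → Graph.Adj G u v) → Perfect G
multipartite⇒perfect G c proper complete = clique+colouring⇒perfect G λ S →
  let open Representatives (representatives (_∈? S) c) in
  size ,
  (rep , λ i j i≢j → complete _ _ (distinct i j i≢j)) ,
  (λ (x , x∈S) → proj₁ (cover x x∈S)) ,
  λ (u , u∈S) (v , v∈S) adj same → proper u v adj
    (trans (sym (proj₂ (cover u u∈S))) (trans (cong (c ∘ proj₁ ∘ rep) same) (proj₂ (cover v v∈S))))

-- In an induced subgraph both numbers are 2, 1 or 0, according to whether there is an edge, only a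
-- vertex, or nothing.
bipartite⇒perfect : ∀ {n} (G : Graph (Fin n)) → (∀ u v → Dec (Graph.Adj G u v)) → Colouring G 2 → Perfect G
bipartite⇒perfect {n} G Adj? (c , proper) = clique+colouring⇒perfect G λ S → case edge? S of λ where
    (yes (u , u∈S , v , v∈S , adj)) →
      2 , ((λ { 0F → u , u∈S ; 1F → v , v∈S }) ,
           λ { 0F 0F 0≢0 → contradiction refl 0≢0 ; 0F 1F _ → adj
             ; 1F 0F _ → symmetric adj ; 1F 1F 1≢1 → contradiction refl 1≢1 }) ,
          (c ∘ proj₁ , λ u v → proper (proj₁ u) (proj₁ v))
    (no edgeless) → case Finₚ.any? (_∈? S) of λ where
      (yes v∈S) →
        1 , ((λ _ → v∈S) , λ { 0F 0F 0≢0 → contradiction refl 0≢0 }) ,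
            ((λ _ → 0F) , λ (u , u∈S) (v , v∈S) adj _ → edgeless (u , u∈S , v , v∈S , adj))
      (no empty) →
        0 , ((λ ()) , λ ()) , ((λ v∈S → contradiction v∈S empty) , λ u _ _ _ → contradiction u empty)
  where
  open Graph G
  edge? : ∀ S → Dec (∃[ u ] u ∈ S × ∃[ v ] v ∈ S × Adj u v)
  edge? S = Finₚ.any? λ u → (u ∈? S) ×-dec Finₚ.any? λ v → (v ∈? S) ×-dec Adj? u v

next : Fin 5 → Fin 5
next 0F = 1F
next 1F = 2F
next 2F = 3F
next 3F = 4F
next 4F = 0F

Consecutive : Fin 5 → Fin 5 → Set
Consecutive i j = i ≡ next j ⊎ j ≡ next i

consecutive? : ∀ i j → Dec (Consecutive i j)
consecutive? i j = (i Finₚ.≟ next j) ⊎-dec (j Finₚ.≟ next i)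

pentagon-triangle-free : ∀ i j k → Consecutive i j → Consecutive j k → ¬ Consecutive i k
pentagon-triangle-free = from-yes (Finₚ.all? λ i → Finₚ.all? λ j → Finₚ.all? λ k →
  consecutive? i j →-dec consecutive? j k →-dec ¬? (consecutive? i k))

pentagon-pairs : ∀ i j → i ≡ j ⊎ Consecutive i j ⊎ i ≡ next (next j) ⊎ j ≡ next (next i)
pentagon-pairs = from-yes (Finₚ.all? λ i → Finₚ.all? λ j →
  (i Finₚ.≟ j) ⊎-dec consecutive? i j ⊎-dec (i Finₚ.≟ next (next j)) ⊎-dec (j Finₚ.≟ next (next i)))

pentagon-not-2-colourable : (c : Fin 5 → Fin 2) → ¬ (∀ i → c i ≢ c (next i))
pentagon-not-2-colourable c proper = proper 4F (sym (trans
    (other (c 0F) (c 1F) (c 2F) (proper 0F) (proper 1F))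
    (other (c 2F) (c 3F) (c 4F) (proper 2F) (proper 3F))))
  where
  other : ∀ (x y z : Fin 2) → x ≢ y → y ≢ z → x ≡ z
  other = from-yes (Finₚ.all? λ (x : Fin 2) → Finₚ.all? λ y → Finₚ.all? λ z →
    ¬? (x Finₚ.≟ y) →-dec ¬? (y Finₚ.≟ z) →-dec (x Finₚ.≟ z))

module _ {m n} (f : Fin m → Fin n) where
  private
    hit? : ∀ v → Dec (∃[ i ] f i ≡ v)
    hit? v = Finₚ.any? λ i → f i Finₚ.≟ v

  image : Subset n
  image = Vec.tabulate (does ∘ hit?)

  image⁺ : ∀ i → f i ∈ image
  image⁺ i = lookup⇒[]= (f i) image
    (trans (lookup∘tabulate (does ∘ hit?) (f i)) (dec-true (hit? (f i)) (i , refl)))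

  image⁻ : ∀ {v} → v ∈ image → ∃[ i ] f i ≡ v
  image⁻ {v} v∈ with hit? v | trans (sym (lookup∘tabulate (does ∘ hit?) v)) ([]=⇒lookup v∈)
  ... | yes hit | _ = hit
  ... | no _    | ()

-- On the image of `f` the common value `k` of the two numbers is impossible: `k ≤ 2` would 2-colour
-- a 5-cycle, and a larger `k` would put a triangle into it.
pentagon⇒¬perfect : ∀ {n} (G : Graph (Fin n)) (f : Fin 5 → Fin n) →
  (∀ i → Graph.Adj G (f i) (f (next i))) →
  (∀ i → ¬ Graph.Adj G (f i) (f (next (next i)))) → ¬ Perfect G
pentagon⇒¬perfect {n} G f edge nonedge perfect
  with k , ((g , g-adj) , _) , ((c , proper) , _) ← perfect (image f)
  with k ℕₚ.≤? 2
... | yes k≤2 = pentagon-not-2-colourable (λ i → Fin.inject≤ (c (f i , image⁺ f i)) k≤2)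
      λ i e → proper _ _ (edge i) (Finₚ.inject≤-injective k≤2 k≤2 _ _ e)
... | no  k≰2 = pentagon-triangle-free (index 0F) (index 1F) (index 2F)
      (consecutive 0F 1F λ ()) (consecutive 1F 2F λ ()) (consecutive 0F 2F λ ())
  where
  open Graph G
  vertex : Fin 3 → ∃[ v ] v ∈ image f
  vertex i = g (Fin.inject≤ i (ℕₚ.≰⇒> k≰2))

  index : Fin 3 → Fin 5
  index i = proj₁ (image⁻ f (proj₂ (vertex i)))

  index-adj : ∀ i j → i ≢ j → Adj (f (index i)) (f (index j))
  index-adj i j i≢j = subst₂ Adj
    (sym (proj₂ (image⁻ f (proj₂ (vertex i))))) (sym (proj₂ (image⁻ f (proj₂ (vertex j)))))
    (g-adj _ _ (i≢j ∘ Finₚ.inject≤-injective _ _ i j))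

  adj⇒consecutive : ∀ {i j} → Adj (f i) (f j) → Consecutive i j
  adj⇒consecutive {i} {j} adj with pentagon-pairs i j
  ... | inj₁ refl               = contradiction adj (irreflexive refl)
  ... | inj₂ (inj₁ c)           = c
  ... | inj₂ (inj₂ (inj₁ refl)) = contradiction (symmetric adj) (nonedge j)
  ... | inj₂ (inj₂ (inj₂ refl)) = contradiction adj (nonedge i)

  consecutive : ∀ i j → i ≢ j → Consecutive (index i) (index j)
  consecutive i j i≢j = adj⇒consecutive (index-adj i j i≢j)

-- Adjacency as a congruence condition

SignedSquare[_] : ℕ → ℤ → Set
SignedSquare[ n ] x = Square[ n ] x ⊎ Square[ n ] (- x)

⟦_⟧ : ∀ {n} → Fin n → ℤ
⟦ a ⟧ = + toℕ a

module _ {n} .{{_ : NonZero n}} where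
  private module R = CommutativeRing (ℤ/ n)

  mod-≈ : ∀ a → ⟦ a mod n ⟧ ≈ + a [ n ]
  mod-≈ a = ≈-sym (congruent (divides (+ (a ℕ./ n)) (begin
    + a - ⟦ a mod n ⟧                             ≡⟨ cong (λ r → + a - + r) (Finₚ.toℕ-fromℕ< (m%n<n a n)) ⟩
    + a - + (a ℕ.% n)                             ≡⟨ cong (λ b → + b - + (a ℕ.% n)) (m≡m%n+[m/n]*n a n) ⟩
    + (a ℕ.% n) + + (a ℕ./ n ℕ.* n) - + (a ℕ.% n) ≡⟨ lemma (+ (a ℕ.% n)) (+ (a ℕ./ n ℕ.* n)) ⟩
    + (a ℕ./ n ℕ.* n)                             ≡⟨ ℤₚ.pos-* (a ℕ./ n) n ⟩
    + (a ℕ./ n) * + n                             ∎)))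
    where
    open ≡-Reasoning
    lemma : ∀ x y → x + y - x ≡ y
    lemma = solve-∀

  ⟦+⟧ : ∀ x y → ⟦ x R.+ y ⟧ ≈ ⟦ x ⟧ + ⟦ y ⟧ [ n ]
  ⟦+⟧ x y = mod-≈ (toℕ x ℕ.+ toℕ y)

  ⟦*⟧ : ∀ x y → ⟦ x R.* y ⟧ ≈ ⟦ x ⟧ * ⟦ y ⟧ [ n ]
  ⟦*⟧ x y = ≈-trans (mod-≈ (toℕ x ℕ.* toℕ y)) (≈-reflexive (ℤₚ.pos-* (toℕ x) (toℕ y)))

  ⟦-⟧ : ∀ x → ⟦ R.- x ⟧ ≈ - ⟦ x ⟧ [ n ]
  ⟦-⟧ x = begin
    ⟦ R.- x ⟧            ≈⟨ mod-≈ (n ℕ.∸ toℕ x) ⟩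
    + (n ℕ.∸ toℕ x)      ≡⟨ ℤₚ.⊖-≥ (Finₚ.toℕ≤n x) ⟨
    n ℤ.⊖ toℕ x          ≡⟨ ℤₚ.[+m]-[+n]≡m⊖n n (toℕ x) ⟨
    + n - ⟦ x ⟧          ≈⟨ +-cong (∣⇒≈0 {n} ∣ℤ.∣-refl) (≈-refl {x = - ⟦ x ⟧}) ⟩
    0ℤ - ⟦ x ⟧           ≡⟨ ℤₚ.+-identityˡ _ ⟩
    - ⟦ x ⟧              ∎
    where open ≈-Reasoning n

  ⟦1⟧ : ⟦ R.1# ⟧ ≈ 1ℤ [ n ]
  ⟦1⟧ = mod-≈ 1

  ⟦-⟧₂ : ∀ x y → ⟦ x R.- y ⟧ ≈ ⟦ x ⟧ - ⟦ y ⟧ [ n ]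
  ⟦-⟧₂ x y = ≈-trans (⟦+⟧ x (R.- y)) (+-cong (≈-refl {x = ⟦ x ⟧}) (⟦-⟧ y))

  Unit⇒unit : ∀ {u} → Unit n u → Unit[ n ] ⟦ u ⟧
  Unit⇒unit {u} (v , _ , uv≡1) = unit ⟦ v ⟧
    (≈-trans (≈-sym (⟦*⟧ u v)) (≈-trans (≈-reflexive (cong ⟦_⟧ uv≡1)) ⟦1⟧))

  unit⇒Unit : ∀ {u} → Unit[ n ] ⟦ u ⟧ → Unit n u
  unit⇒Unit {u} (unit i p) = v , trans (R.*-comm v u) uv≡1 , uv≡1
    where
    v = residue n i
    uv≡1 : u R.* v ≡ R.1#
    uv≡1 = toℕ-≈-injective (≈-trans (⟦*⟧ u v) (≈-trans (*-cong (≈-refl {x = ⟦ u ⟧}) (residue-≈ i))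
      (≈-trans p (≈-sym ⟦1⟧))))

  T⇒signedSquare : ∀ {x} → T n x → SignedSquare[ n ] ⟦ x ⟧
  T⇒signedSquare (_ , (u , U , refl) , inj₁ refl) = inj₁ (square ⟦ u ⟧ (Unit⇒unit U) (⟦*⟧ u u))
  T⇒signedSquare (_ , (u , U , refl) , inj₂ refl) = inj₂ (square ⟦ u ⟧ (Unit⇒unit U) (begin
    - ⟦ R.- (u R.* u) ⟧    ≈⟨ neg-cong (⟦-⟧ (u R.* u)) ⟩
    - - ⟦ u R.* u ⟧        ≡⟨ ℤₚ.neg-involutive _ ⟩
    ⟦ u R.* u ⟧            ≈⟨ ⟦*⟧ u u ⟩
    ⟦ u ⟧ * ⟦ u ⟧          ∎))
    where open ≈-Reasoning n

  signedSquare⇒T : ∀ {x} → SignedSquare[ n ] ⟦ x ⟧ → T n x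
  signedSquare⇒T {x} = ⊎.[ (λ s → _ , quadratic s , inj₁ (toℕ-≈-injective (reduced s)))
                         , (λ s → _ , quadratic s , inj₂ (toℕ-≈-injective (begin
      ⟦ x ⟧                                                    ≡⟨ ℤₚ.neg-involutive _ ⟨
      - - ⟦ x ⟧                                                ≈⟨ neg-cong (reduced s) ⟩
      - ⟦ rootOf s R.* rootOf s ⟧                              ≈⟨ ⟦-⟧ (rootOf s R.* rootOf s) ⟨
      ⟦ R.- (rootOf s R.* rootOf s) ⟧                          ∎))) ]
    where
    open ≈-Reasoning n
    rootOf : ∀ {y} → Square[ n ] y → Fin n
    rootOf s = residue n (Square[_].root s)
    quadratic : ∀ {y} (s : Square[ n ] y) → Q n (rootOf s R.* rootOf s)
    quadratic s = rootOf s , unit⇒Unit (unit-resp (≈-sym (residue-≈ _)) (Square[_].isUnit s)) , refl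
    reduced : ∀ {y} (s : Square[ n ] y) → y ≈ ⟦ rootOf s R.* rootOf s ⟧ [ n ]
    reduced (square r U p) = ≈-trans p (≈-sym (≈-trans (⟦*⟧ (residue n r) (residue n r))
      (*-cong (residue-≈ r) (residue-≈ r))))

  unit? : ∀ u → Dec (Unit[ n ] u)
  unit? u = map′ (λ (i , p) → unit ⟦ i ⟧ p)
    (λ (unit i p) → residue n i , ≈-trans (*-cong (≈-refl {x = u}) (residue-≈ i)) p)
    (Finₚ.any? λ i → (u * ⟦ i ⟧) ≈? 1ℤ [ n ])

  residue-square : ∀ r → r * r ≈ ⟦ residue n r ⟧ * ⟦ residue n r ⟧ [ n ]
  residue-square r = ≈-sym (*-cong {x = ⟦ residue n r ⟧} {u = ⟦ residue n r ⟧} (residue-≈ r) (residue-≈ r))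

  -- A root may be reduced modulo `n`, so a search through the residues suffices. The later searches
  -- for a least nonsquare and a least bad integer rest on this.
  square? : ∀ x → Dec (Square[ n ] x)
  square? x = map′ to from (Finₚ.any? root?)
    where
    Root : Fin n → Set
    Root r = Unit[ n ] ⟦ r ⟧ × x ≈ ⟦ r ⟧ * ⟦ r ⟧ [ n ]
    root? : ∀ r → Dec (Root r)
    root? r = unit? ⟦ r ⟧ ×-dec (x ≈? (⟦ r ⟧ * ⟦ r ⟧) [ n ])
    to : ∃ Root → Square[ n ] x
    to (r , U , p) = square ⟦ r ⟧ U p
    from : Square[ n ] x → ∃ Root
    from (square r U p) = residue n r , unit-resp (≈-sym (residue-≈ r)) U , ≈-trans p (residue-square r)

signedSquare-resp : ∀ {n x y} → x ≈ y [ n ] → SignedSquare[ n ] x → SignedSquare[ n ] y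
signedSquare-resp p = ⊎.map (square-resp p) (square-resp (neg-cong p))

signedSquare⇒unit : ∀ {n x} → SignedSquare[ n ] x → Unit[ n ] x
signedSquare⇒unit (inj₁ s) = square⇒unit s
signedSquare⇒unit {n} {x} (inj₂ s) = subst Unit[ n ] (ℤₚ.neg-involutive x) (neg-unit (square⇒unit s))

signedSquare-weaken : ∀ {m n x} → + m ∣ℤ + n → SignedSquare[ n ] x → SignedSquare[ m ] x
signedSquare-weaken m∣n = ⊎.map (square-weaken m∣n) (square-weaken m∣n)

module _ (n : ℕ) .{{_ : NonZero n}} where
  private module R = CommutativeRing (ℤ/ n)
  open Graph (QuadraticUnitaryCayley n)

  adj⇒signedSquare : ∀ {a b} → Adj a b → SignedSquare[ n ] (⟦ a ⟧ - ⟦ b ⟧)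
  adj⇒signedSquare {a} {b} (_ , t) = signedSquare-resp (⟦-⟧₂ a b) (T⇒signedSquare t)

  signedSquare⇒adj : ∀ {a b} → a ≢ b → SignedSquare[ n ] (⟦ a ⟧ - ⟦ b ⟧) → Adj a b
  signedSquare⇒adj {a} {b} a≢b s = a≢b , signedSquare⇒T (signedSquare-resp (≈-sym (⟦-⟧₂ a b)) s)

  adj? : ∀ a b → Dec (Adj a b)
  adj? a b = map′ (λ (a≢b , s) → signedSquare⇒adj a≢b s) (λ adj → proj₁ adj , adj⇒signedSquare adj)
    (¬? (a Finₚ.≟ b) ×-dec (square? (⟦ a ⟧ - ⟦ b ⟧) ⊎-dec square? (- (⟦ a ⟧ - ⟦ b ⟧))))

  -- The difference of adjacent vertices is a unit modulo `n`. Hence reduction modulo any divisor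
  -- `d` of `n` other than 1 is a proper colouring.
  adj⇒≉ : ∀ {d a b} → + d ∣ℤ + n → d ≢ 1 → Adj a b → ¬ (⟦ a ⟧ ≈ ⟦ b ⟧ [ d ])
  adj⇒≉ d∣n d≢1 adj (congruent d∣a-b) = d≢1 (unit-∣⇒≡1 (signedSquare⇒unit (adj⇒signedSquare adj)) d∣n d∣a-b)

residue-injective : ∀ {d} .{{_ : NonZero d}} {x y} → residue d x ≡ residue d y → x ≈ y [ d ]
residue-injective {d} {x} {y} e =
  ≈-trans (≈-sym (residue-≈ x)) (≈-trans (≈-reflexive (cong ⟦_⟧ e)) (residue-≈ y))

-- The two perfect families

even⇒perfect : ∀ n .{{_ : NonZero n}} → 2 ∣ n → Perfect (QuadraticUnitaryCayley n)
even⇒perfect n 2∣n = bipartite⇒perfect (QuadraticUnitaryCayley n) (adj? n)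
  ((λ v → residue 2 ⟦ v ⟧) , λ u v adj same → adj⇒≉ n (∣ℕ⇒∣ 2∣n) (λ ()) adj (residue-injective same))

prime-power⇒perfect : ∀ k (let p = suc (suc (k ℕ.* 2) ℕ.* 2)) → Prime p → ∀ m .{{_ : NonZero (p ^ m)}} →
                      Perfect (QuadraticUnitaryCayley (p ^ m))
-- Here `p ^ 0` is 1: there is a single vertex, and the condition `a ≢ b` in the adjacency removes
-- its loop.
prime-power⇒perfect k p-prime zero    = multipartite⇒perfect (QuadraticUnitaryCayley 1) (λ _ → 0)
  (λ { 0F 0F (0≢0 , _) _ → 0≢0 refl }) (λ _ _ 0≢0 → contradiction refl 0≢0)
prime-power⇒perfect k p-prime (suc a) = multipartite⇒perfect (QuadraticUnitaryCayley n) (λ v → toℕ (residue p ⟦ v ⟧))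
  (λ u v adj same → adj⇒≉ n (∣ℕ⇒∣ (∣ℕ.m∣m*n (p ^ a))) (prime≢1 p-prime) adj
    (residue-injective (Finₚ.toℕ-injective same)))
  (λ u v distinct → signedSquare⇒adj n (distinct ∘ cong (λ w → toℕ (residue p ⟦ w ⟧)))
    (signed-square k p-prime {⟦ u ⟧ - ⟦ v ⟧} a λ u-v≈0 → distinct (cong toℕ (residue-toℕ
      (≈-trans (-≈0⇒≈ {x = ⟦ u ⟧} {⟦ v ⟧} u-v≈0) (≈-sym (residue-≈ ⟦ v ⟧)))))))
  where
  p = suc (suc (k ℕ.* 2) ℕ.* 2)
  n = p ^ suc a

-- Translates of a clique, and primes congruent to 1 modulo 4

open Sum ℕₚ.+-0-commutativeMonoid using (sum; sum-remove; sum-permute; sum-cong-≗; sum-replicate-zero; ∑-comm)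

δ : ∀ {k} → Fin k → Fin k → ℕ
δ i j = if does (i Finₚ.≟ j) then 1 else 0

-- If `j` were missed, punching it out of the codomain would inject k + 1 elements into k.
injective⇒surjective : ∀ {k} {g : Fin k → Fin k} → Injective _≡_ _≡_ g → ∀ j → ∃[ i ] g i ≡ j
injective⇒surjective {suc k} {g} inj j with Finₚ.any? (λ i → g i Finₚ.≟ j)
... | yes hit = hit
... | no miss = contradiction
  (Finₚ.injective⇒≤ {f = λ i → punchOut (missed i)}
    λ {x} {y} e → inj (Finₚ.punchOut-injective (missed x) (missed y) e))
  ℕₚ.1+n≰n
  where
  missed : ∀ i → j ≢ g i
  missed i e = miss (i , sym e)

sum-const : ∀ k a → sum {k} (λ _ → a) ≡ k ℕ.* a
sum-const zero    a = refl
sum-const (suc k) a = cong (a ℕ.+_) (sum-const k a)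

-- Exactly one index is sent to `j`: one exists by surjectivity, and the others contribute 0 by
-- injectivity.
sum-δ : ∀ {k} {g : Fin k → Fin k} → Injective _≡_ _≡_ g → ∀ j → sum (λ i → δ (g i) j) ≡ 1
sum-δ {suc k} {g} inj j with i , refl ← injective⇒surjective inj j = begin
  sum (λ i′ → δ (g i′) (g i))                        ≡⟨ sum-remove {i = i} (λ i′ → δ (g i′) (g i)) ⟩
  δ (g i) (g i) ℕ.+ sum (λ l → δ (g (punchIn i l)) (g i))
    ≡⟨ cong₂ ℕ._+_ (cong (if_then 1 else 0) (dec-true (g i Finₚ.≟ g i) refl))
                   (sum-cong-≗ λ l → cong (if_then 1 else 0)
                     (dec-false (g (punchIn i l) Finₚ.≟ g i) (Finₚ.punchInᵢ≢i i l ∘ inj))) ⟩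
  1 ℕ.+ sum {k} (λ _ → 0)                            ≡⟨ cong suc (sum-replicate-zero k) ⟩
  1                                                  ∎
  where open ≡-Reasoning

module _ (n : ℕ) .{{_ : NonZero n}} where
  private module R = CommutativeRing (ℤ/ n)
  open Graph (QuadraticUnitaryCayley n)
  open GroupProperties R.+-group using (\\-leftDividesˡ; \\-leftDividesʳ)

  translation : Fin n → Permutation n n
  translation x = permutation (x R.+_) (R.- x R.+_) (\\-leftDividesˡ x) (\\-leftDividesʳ x)

  translate-adj : ∀ {a b} t → Adj a b → Adj (a R.+ t) (b R.+ t)
  translate-adj {a} {b} t adj = signedSquare⇒adj n
    (λ e → proj₁ adj (toℕ-≈-injective (-≈0⇒≈ (≈-trans (≈-sym difference)
      (≈⇒-≈0 (≈-reflexive (cong ⟦_⟧ e)))))))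
    (signedSquare-resp (≈-sym difference) (adj⇒signedSquare n adj))
    where
    lemma : ∀ a b t → (a + t) - (b + t) ≡ a - b
    lemma = solve-∀
    difference : ⟦ a R.+ t ⟧ - ⟦ b R.+ t ⟧ ≈ ⟦ a ⟧ - ⟦ b ⟧ [ n ]
    difference = ≈-trans (-‿cong (⟦+⟧ a t) (⟦+⟧ b t)) (≈-reflexive (lemma ⟦ a ⟧ ⟦ b ⟧ ⟦ t ⟧))

  -- With as many colours as a clique has vertices, each translate of the clique
  -- meets a given colour class exactly once; count the incidences of translates
  -- with that class.
  clique-divides-order : ∀ {k} → Clique (QuadraticUnitaryCayley n) (suc k) →
                         Colouring (QuadraticUnitaryCayley n) (suc k) → suc k ∣ n
  clique-divides-order {k} (f , f-adj) (c , proper) = ∣ℕ.divides class (begin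
    n                                                ≡⟨ ℕₚ.*-identityʳ n ⟨
    n ℕ.* 1                                          ≡⟨ sum-const n 1 ⟨
    sum {n} (λ _ → 1)                                ≡⟨ sum-cong-≗ (λ t → sum-δ (rainbow t) 0F) ⟨
    sum (λ t → sum (λ i → δ (c (f i R.+ t)) 0F))     ≡⟨ ∑-comm (λ t i → δ (c (f i R.+ t)) 0F) ⟩
    sum (λ i → sum (λ t → δ (c (f i R.+ t)) 0F))
      ≡⟨ sum-cong-≗ (λ i → sum-permute (λ t → δ (c t) 0F) (translation (f i))) ⟨
    sum {suc k} (λ _ → sum (λ t → δ (c t) 0F))       ≡⟨ sum-const (suc k) class ⟩
    suc k ℕ.* class                                  ≡⟨ ℕₚ.*-comm (suc k) class ⟩
    class ℕ.* suc k                                  ∎)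
    where
    open ≡-Reasoning
    class = sum (λ t → δ (c t) 0F)
    rainbow : ∀ t → Injective _≡_ _≡_ (λ i → c (f i R.+ t))
    rainbow t {i} {j} e = decidable-stable (i Finₚ.≟ j) λ i≢j →
      proper _ _ (translate-adj t (f-adj i j i≢j)) e

1≉0 : ∀ {n} → n ≢ 1 → ¬ (1ℤ ≈ 0ℤ [ n ])
1≉0 n≢1 e = n≢1 (∣ℕ.∣1⇒≡1 (≈0⇒∣ℕ e))

-- The edge between 0 and 1 forces the clique number to be at least 2, so that it can be compared
-- with the least divisor exceeding 1.
edge : ∀ n .{{_ : NonZero n}} → n ≢ 1 → Clique (induced (QuadraticUnitaryCayley n) ⊤) 2
edge n n≢1 = (λ i → residue n (+ toℕ i) , ∈⊤) , λ
  { 0F 0F 0≢0 → contradiction refl 0≢0 ; 0F 1F _ → Graph.symmetric G adj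
  ; 1F 0F _ → adj ; 1F 1F 1≢1 → contradiction refl 1≢1 }
  where
  G = QuadraticUnitaryCayley n
  adj : Graph.Adj G (residue n 1ℤ) (residue n 0ℤ)
  adj = signedSquare⇒adj n (λ e → 1≉0 n≢1 (residue-injective e))
    (inj₁ (square-resp (≈-sym (-‿cong (residue-≈ 1ℤ) (residue-≈ 0ℤ))) 1-square))

prime-1mod4⇒¬perfect : ∀ n .{{_ : NonZero n}} k (let p = suc (suc k ℕ.* 2 ℕ.* 2)) → Prime p →
  p ∣ n → (∀ d → 1 ℕ.< d → d ∣ n → p ℕ.≤ d) → ¬ Perfect (QuadraticUnitaryCayley n)
prime-1mod4⇒¬perfect n k p-prime p∣n least perfect with perfect ⊤
... | ω , ((f , f-adj) , max) , ((c , proper) , _) = case ω≡p of λ { refl → no-p-clique (proj₁ ∘ f) f-adj }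
  where
  p = suc (suc k ℕ.* 2 ℕ.* 2)
  h = suc k ℕ.* 2
  open Graph (QuadraticUnitaryCayley n)

  distinct : ∀ {a b} → Adj a b → ¬ (⟦ a ⟧ ≈ ⟦ b ⟧ [ p ])
  distinct = adj⇒≉ n (∣ℕ⇒∣ p∣n) (prime≢1 p-prime)

  ω≤p : ω ℕ.≤ p
  ω≤p = Finₚ.injective⇒≤ {f = λ i → residue p ⟦ proj₁ (f i) ⟧} λ {i} {j} e →
    decidable-stable (i Finₚ.≟ j) λ i≢j → distinct (f-adj i j i≢j) (residue-injective e)

  2≤ω : 2 ℕ.≤ ω
  2≤ω = max 2 (edge n λ n≡1 → prime≢1 p-prime (∣ℕ.∣1⇒≡1 (subst (p ∣_) n≡1 p∣n)))

  ω∣n : ∀ {ω} → 2 ℕ.≤ ω → Clique (induced (QuadraticUnitaryCayley n) ⊤) ω →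
        Colouring (induced (QuadraticUnitaryCayley n) ⊤) ω → ω ∣ n
  ω∣n {suc ω} _ (f , f-adj) (c , proper) = clique-divides-order n (proj₁ ∘ f , f-adj)
    ((λ v → c (v , ∈⊤)) , λ u v → proper (u , ∈⊤) (v , ∈⊤))

  ω≡p : ω ≡ p
  ω≡p = ℕₚ.≤-antisym ω≤p (least ω 2≤ω (ω∣n 2≤ω (f , f-adj) (c , proper)))

  -- Here h = (p - 1)/2 is even, so the sign in front of the square disappears.
  half-power-1 : ∀ {x} → SignedSquare[ p ] x → x ^ℤ h ≈ 1ℤ [ p ]
  half-power-1 (inj₁ s) = square⇒half-power h p-prime s
  half-power-1 {x} (inj₂ s) = subst (_≈ 1ℤ [ p ]) (neg-^-even x (suc k)) (square⇒half-power h p-prime s)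

  no-p-clique : (f : Fin p → Fin n) → ¬ (∀ i j → i ≢ j → Adj (f i) (f j))
  no-p-clique f f-adj = unity-root-bound p-prime (λ i → ⟦ f (index i) ⟧ - ⟦ f 0F ⟧)
    (λ i j e → decidable-stable (i Finₚ.≟ j) λ i≢j →
      distinct (f-adj (index i) (index j) (i≢j ∘ index-injective)) (cancel ⟦ f 0F ⟧ e))
    (λ i → half-power-1 (signedSquare-weaken (∣ℕ⇒∣ p∣n) (adj⇒signedSquare n (f-adj (index i) 0F λ ()))))
    where
    -- Of the 2h = p - 1 differences from the vertex `f 0F`, h + 1 already exceed the number of
    -- roots of x^h = 1. The `suc` in `index` skips the base vertex itself.
    bound : suc h ℕ.≤ h ℕ.* 2
    bound = ℕ.s≤s (ℕ.s≤s (ℕ.s≤s (ℕₚ.≤-trans (ℕₚ.m≤m*n (k ℕ.* 2) 2) (ℕₚ.n≤1+n _))))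

    index : Fin (suc h) → Fin p
    index i = suc (Fin.inject≤ i bound)

    index-injective : ∀ {i j} → index i ≡ index j → i ≡ j
    index-injective {i} {j} e = Finₚ.inject≤-injective bound bound i j (Finₚ.suc-injective e)

    lemma : ∀ x z → x ≡ x - z + z
    lemma = solve-∀

    cancel : ∀ {x y} z → x - z ≈ y - z [ p ] → x ≈ y [ p ]
    cancel {x} {y} z e = ≈-trans (≈-reflexive (lemma x z))
      (≈-trans (+-cong e (≈-refl {x = z})) (≈-reflexive (sym (lemma y z))))

-- The pentagon

Least : Pred ℕ 0ℓ → Set
Least P = ∃[ m ] P m × (∀ i → i ℕ.< m → ¬ P i)

least : ∀ {P : Pred ℕ 0ℓ} → Decidable P → ∀ b → P b → Least P
least {P} P? = <-rec (λ b → P b → Least P) step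
  where
  step : ∀ b → (∀ {i} → i ℕ.< b → P i → Least P) → P b → Least P
  step b rec Pb with ℕₚ.anyUpTo? P? b
  ... | yes (i , i<b , Pi) = rec i<b Pi
  ... | no none            = b , Pb , λ i i<b Pi → none (i , i<b , Pi)

mod-3 : ∀ x → x ≈ 0ℤ [ 3 ] ⊎ x ≈ 1ℤ [ 3 ] ⊎ x ≈ -1ℤ [ 3 ]
mod-3 x with residue 3 x | residue-≈ {3} x
... | 0F | p = inj₁ (≈-sym p)
... | 1F | p = inj₂ (inj₁ (≈-sym p))
... | 2F | p = inj₂ (inj₂ (≈-trans (≈-sym p) (congruent (divides 1ℤ refl))))

1≉0[3] : ¬ (1ℤ ≈ 0ℤ [ 3 ])
1≉0[3] = from-no (1ℤ ≈? 0ℤ [ 3 ])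

-1≉0[3] : ¬ (-1ℤ ≈ 0ℤ [ 3 ])
-1≉0[3] = from-no (-1ℤ ≈? 0ℤ [ 3 ])

1≉-1[3] : ¬ (1ℤ ≈ -1ℤ [ 3 ])
1≉-1[3] = from-no (1ℤ ≈? -1ℤ [ 3 ])

-- The connection set of the tensor product of the directed triangle with the
-- Cayley digraph of the unit squares modulo N, pulled back to ℤ.
TripleSquare[_] : ℕ → ℤ → Set
TripleSquare[ N ] x = x ≈ 1ℤ [ 3 ] × Square[ N ] x ⊎ x ≈ -1ℤ [ 3 ] × Square[ N ] (- x)

module _ {N : ℕ} where
  private L = TripleSquare[ N ]

  triple-neg : ∀ {x} → L x → L (- x)
  triple-neg {x} (inj₁ (p , s)) = inj₂ (neg-cong p , subst Square[ N ] (sym (ℤₚ.neg-involutive x)) s)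
  triple-neg (inj₂ (p , s)) = inj₁ (neg-cong p , s)

  triple-neg⁻ : ∀ {x} → L (- x) → L x
  triple-neg⁻ {x} l = subst L (ℤₚ.neg-involutive x) (triple-neg l)

  private
    *-pos : ∀ {x y} → x ≈ 1ℤ [ 3 ] → Square[ N ] x → L y → L (x * y)
    *-pos p s (inj₁ (q , t)) = inj₁ (*-cong p q , *-square s t)
    *-pos {x} {y} p s (inj₂ (q , t)) = inj₂ (*-cong p q ,
      subst Square[ N ] (sym (ℤₚ.neg-distribʳ-* x y)) (*-square s t))

    cancel-pos : ∀ {x y} → x ≈ 1ℤ [ 3 ] → Square[ N ] x → L (x * y) → L y
    cancel-pos {x} {y} p s = ⊎.map
      (λ (q , t) → ≈-trans y≈xy q , square-cancelˡ s t)
      (λ (q , t) → ≈-trans y≈xy q , square-cancelˡ s (subst Square[ N ] (ℤₚ.neg-distribʳ-* x y) t))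
      where
      y≈xy : y ≈ x * y [ 3 ]
      y≈xy = ≈-trans (≈-reflexive (sym (ℤₚ.*-identityˡ y))) (*-cong (≈-sym p) ≈-refl)

  -- After replacing `x` by `- x` if necessary, `x` is 1 modulo 3 and a unit square modulo `N`.
  -- Multiplying by such a number preserves either alternative for `y`, and `triple-neg⁻` undoes the
  -- change of sign.
  triple-* : ∀ {x y} → L x → L y → L (x * y)
  triple-* (inj₁ (p , s)) l = *-pos p s l
  triple-* {x} {y} (inj₂ (p , s)) l =
    triple-neg⁻ (subst L (sym (ℤₚ.neg-distribˡ-* x y)) (*-pos (neg-cong p) s l))

  triple-cancelˡ : ∀ {x y} → L x → L (x * y) → L y
  triple-cancelˡ (inj₁ (p , s)) l = cancel-pos p s l
  triple-cancelˡ {x} {y} (inj₂ (p , s)) l =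
    cancel-pos (neg-cong p) s (subst L (ℤₚ.neg-distribˡ-* x y) (triple-neg l))

  triple-1 : L 1ℤ
  triple-1 = inj₁ (≈-refl , 1-square)

  triple-≉0 : ∀ {x} → x ≈ 0ℤ [ 3 ] → ¬ L x
  triple-≉0 z (inj₁ (p , _)) = 1≉0[3] (≈-trans (≈-sym p) z)
  triple-≉0 z (inj₂ (p , _)) = -1≉0[3] (≈-trans (≈-sym p) z)

  triple⁺ : ∀ {x} → x ≈ 1ℤ [ 3 ] → L x → Square[ N ] x
  triple⁺ z (inj₁ (_ , s)) = s
  triple⁺ z (inj₂ (p , _)) = contradiction (≈-trans (≈-sym z) p) 1≉-1[3]

  triple⁻ : ∀ {x} → x ≈ -1ℤ [ 3 ] → L x → Square[ N ] (- x)
  triple⁻ z (inj₁ (p , _)) = contradiction (≈-trans (≈-sym p) z) 1≉-1[3]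
  triple⁻ z (inj₂ (_ , s)) = s

  triple⇒signedSquare : ∀ {x} → L x → SignedSquare[ N ] x
  triple⇒signedSquare = ⊎.map proj₂ proj₂

  triple? : .{{_ : NonZero N}} → ∀ x → Dec (L x)
  triple? x = (x ≈? 1ℤ [ 3 ] ×-dec square? x) ⊎-dec (x ≈? -1ℤ [ 3 ] ×-dec square? (- x))

-- The hypothesis makes - 1 a square, and one of i and m - i is prime to 3, so every
-- nonzero residue would be a square.
¬all-triple : ∀ {m} → Prime m → Odd m → ¬ (+ m ≈ 0ℤ [ 3 ]) →
              ¬ (∀ i → i ℕ.< m → ¬ (+ i ≈ 0ℤ [ 3 ]) → TripleSquare[ m ] (+ i))
¬all-triple m-prime (zero , refl) _ _ = prime≢1 m-prime refl
-- The numbers 1, ..., h + 1 are one root too many for x^h = 1; they lie below m = 2h + 1 because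
-- `h` is positive.
¬all-triple {m} m-prime (h@(suc h′) , refl) m≉0 all = unity-root-bound m-prime (λ i → + suc (toℕ i))
  (λ i j e → Finₚ.toℕ-injective (ℕₚ.suc-injective (≈⇒≡ (small i) (small j) e)))
  (λ i → square⇒half-power h m-prime (all-square (suc (toℕ i)) (small i)))
  where
  small : ∀ (i : Fin (suc h)) → suc (toℕ i) ℕ.< m
  small i = ℕ.s≤s (ℕₚ.≤-trans (Finₚ.toℕ<n i)
    (ℕ.s≤s (ℕ.s≤s (ℕₚ.m≤m*n h′ 2))))

  reflect : ∀ i → + m - + i ≈ - + i [ m ]
  reflect i = ≈-trans (+-cong (∣⇒≈0 {m} ∣ℤ.∣-refl) (≈-refl {x = - + i})) (≈-reflexive (ℤₚ.+-identityˡ (- + i)))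

  complement : ∀ i → i ℕ.≤ m → + (m ℕ.∸ i) ≡ + m - + i
  complement i i≤m = trans (sym (ℤₚ.⊖-≥ i≤m)) (sym (ℤₚ.[+m]-[+n]≡m⊖n m i))

  all-reflected : ∀ i .{{_ : NonZero i}} → i ℕ.≤ m → ¬ (+ m - + i ≈ 0ℤ [ 3 ]) → TripleSquare[ m ] (+ m - + i)
  all-reflected i@(suc _) i≤m ≉0 = subst TripleSquare[ m ] (complement i i≤m)
    (all (m ℕ.∸ i) (ℕₚ.∸-monoʳ-< (ℕ.s≤s ℕ.z≤n) i≤m) (≉0 ∘ subst (_≈ 0ℤ [ 3 ]) (complement i i≤m)))

  -1-square : Square[ m ] -1ℤ
  -1-square with mod-3 (+ m)
  ... | inj₁ m≈0 = contradiction m≈0 m≉0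
  -- Both m - 2 and 2 are -1 modulo 3, so -(m - 2) and -2 are squares. Modulo `m` the former is 2,
  -- and cancelling it from -2 leaves -1.
  ... | inj₂ (inj₁ m≈1) = square-cancelˡ {x = + 2}
      (square-resp (neg-cong (reflect 2)) (triple⁻ m-2≈-1
        (all-reflected 2 (ℕ.s≤s (ℕ.s≤s ℕ.z≤n)) (λ z → -1≉0[3] (≈-trans (≈-sym m-2≈-1) z)))))
      (triple⁻ (congruent (divides 1ℤ refl)) (all 2 (ℕ.s≤s (ℕ.s≤s (ℕ.s≤s ℕ.z≤n))) (from-no (+ 2 ≈? 0ℤ [ 3 ]))))
    where
    m-2≈-1 : + m - + 2 ≈ -1ℤ [ 3 ]
    m-2≈-1 = -‿cong m≈1 (≈-refl {x = + 2})
  ... | inj₂ (inj₂ m≈-1) = square-resp (reflect 1) (triple⁺ m-1≈1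
        (all-reflected 1 (ℕ.s≤s ℕ.z≤n) (λ z → 1≉0[3] (≈-trans (≈-sym m-1≈1) z))))
    where
    m-1≈1 : + m - + 1 ≈ 1ℤ [ 3 ]
    m-1≈1 = ≈-trans (-‿cong m≈-1 (≈-refl {x = + 1})) (congruent (divides -1ℤ refl))

  unsign : ∀ {x} → SignedSquare[ m ] x → Square[ m ] x
  unsign (inj₁ s) = s
  unsign {x} (inj₂ s) = square-cancelˡ -1-square (subst Square[ m ] (sym (ℤₚ.-1*i≡-i x)) s)

  all-square : ∀ i .{{_ : NonZero i}} → i ℕ.< m → Square[ m ] (+ i)
  all-square i i<m with + i ≈? 0ℤ [ 3 ]
  ... | no i≉0  = unsign (triple⇒signedSquare (all i i<m i≉0))
  ... | yes i≈0 = unsign (inj₂ (square-resp (reflect i) (unsign (triple⇒signedSquare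
        (all-reflected i (ℕₚ.<⇒≤ i<m) λ z → m≉0 (≈-trans (-≈0⇒≈ z) i≈0))))))

parity : ∀ n → (∃[ j ] n ≡ j ℕ.* 2) ⊎ Odd n
parity zero = inj₁ (0 , refl)
parity (suc n) with parity n
... | inj₁ (j , refl) = inj₂ (j , refl)
... | inj₂ (j , refl) = inj₁ (suc j , refl)

-- What the pentagon on 0, M - 1, M, 2 M - 1, M² requires: `M-1-edge` and `M-unit` serve its sides,
-- `M-nonedge` and `M≈-1` its diagonals.
record Witness (N : ℕ) (M : ℤ) : Set where
  field
    M≈-1       : M ≈ -1ℤ [ 3 ]
    M-unit     : Unit[ N ] M
    M-nonedge  : ¬ TripleSquare[ N ] M
    M-1-edge   : TripleSquare[ N ] (M - 1ℤ)

module _ {N} .{{_ : NonZero N}} (N≢1 : N ≢ 1) (2∤N : ¬ 2 ∣ N) (3∤N : ¬ 3 ∣ N) where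
  private
    L = TripleSquare[ N ]

    Bad : ℕ → Set
    Bad i = ¬ (+ i ≈ 0ℤ [ 3 ]) × ¬ L (+ i)

    bad? : Decidable Bad
    bad? i = ¬? (+ i ≈? 0ℤ [ 3 ]) ×-dec ¬? (triple? (+ i))

    -- This bounds the search for the least bad integer: `N` is 0 modulo `N`, hence no unit.
    N-bad : Bad N
    N-bad = (3∤N ∘ ≈0⇒∣ℕ) , λ l →
      N≢1 (unit-∣⇒≡1 (signedSquare⇒unit (triple⇒signedSquare l)) ∣ℤ.∣-refl ∣ℤ.∣-refl)

  -- M is ± the least positive integer prime to 3 that is not a TripleSquare.
  least-bad⇒witness : Least Bad → ∃ (Witness N)
  least-bad⇒witness (m , (m≉0 , m-bad) , below) = result
    where
    good : ∀ i → i ℕ.< m → ¬ (+ i ≈ 0ℤ [ 3 ]) → L (+ i)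
    good i i<m i≉0 = decidable-stable (triple? (+ i)) λ ¬l → below i i<m (i≉0 , ¬l)

    m≢0 : m ≢ 0
    m≢0 refl = m≉0 ≈-refl

    m≢1 : m ≢ 1
    m≢1 refl = m-bad triple-1

    -- A divisor of `N` is prime to 3, so below `m` it is good and therefore a unit modulo `N`.
    no-small-divisor : ∀ {d} → d ℕ.< m → d ∣ N → d ≡ 1
    no-small-divisor {d} d<m d∣N = unit-∣⇒≡1
      (signedSquare⇒unit (triple⇒signedSquare (good d d<m λ d≈0 → 3∤N (∣ℕ.∣-trans (≈0⇒∣ℕ d≈0) d∣N))))
      (∣ℕ⇒∣ d∣N) ∣ℤ.∣-refl

    -- If `m` divided `N`, it would be prime, as its smaller divisors are 1, and odd. The good
    -- integers below it would then be triple squares modulo `m` itself, which `¬all-triple`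
    -- excludes.
    m∤N : ¬ (m ∣ N)
    m∤N m∣N = ¬all-triple m-prime m-odd m≉0 λ i i<m i≉0 →
      ⊎.map weaken weaken (good i i<m i≉0)
      where
      weaken : ∀ {ε x y} → x ≈ ε [ 3 ] × Square[ N ] y → x ≈ ε [ 3 ] × Square[ m ] y
      weaken (p , s) = p , square-weaken (∣ℕ⇒∣ m∣N) s
      m-prime : Prime m
      m-prime = prime {{ℕ.n>1⇒nonTrivial (ℕₚ.≤∧≢⇒< (ℕₚ.n≢0⇒n>0 m≢0) (m≢1 ∘ sym))}}
        λ { (composite {d} d<m d∣m) → ℕ.nonTrivial⇒≢1 {d} (no-small-divisor d<m (∣ℕ.∣-trans d∣m m∣N)) }
      m-odd : Odd m
      m-odd with parity m
      ... | inj₁ (j , refl) = contradiction (∣ℕ.∣-trans (∣ℕ.n∣m*n j) m∣N) 2∤N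
      ... | inj₂ odd        = odd

    m-unit : Unit[ N ] (+ m)
    m-unit = coprime⇒unit λ {d} (d∣m , d∣N) → case ℕₚ.m≤n⇒m<n∨m≡n (∣ℕ.∣⇒≤ {{ℕ.≢-nonZero m≢0}} d∣m) of λ where
      (inj₁ d<m)  → no-small-divisor d<m d∣N
      (inj₂ refl) → contradiction d∣N m∤N

    predecessor : + m ≈ -1ℤ [ 3 ] → L (+ m - 1ℤ)
    predecessor m≈-1 = subst L eq (good (ℕ.pred m) (ℕₚ.≤-reflexive (ℕₚ.suc-pred m {{ℕ.≢-nonZero m≢0}}))
      λ e → 1≉0[3] (≈-trans (≈-sym m-1≈1) (subst (_≈ 0ℤ [ 3 ]) eq e)))
      where
      m-1≈1 : + m - 1ℤ ≈ 1ℤ [ 3 ]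
      m-1≈1 = ≈-trans (-‿cong m≈-1 (≈-refl {x = 1ℤ})) (congruent (divides -1ℤ refl))
      eq : + ℕ.pred m ≡ + m - 1ℤ
      eq = cong (λ z → + z - 1ℤ) (ℕₚ.suc-pred m {{ℕ.≢-nonZero m≢0}})

    double : ∀ j → j ℕ.< m → 2 ℕ.< m → ¬ (+ (j ℕ.* 2) ≈ 0ℤ [ 3 ]) → L (+ (j ℕ.* 2))
    double j j<m 2<m 2j≉0 = subst L (sym (ℤₚ.pos-* j 2)) (triple-* {x = + j} {+ 2}
      (good j j<m λ j≈0 → 2j≉0 (∣ℕ⇒≈0 (∣ℕ.∣m⇒∣m*n 2 (≈0⇒∣ℕ j≈0))))
      (good 2 2<m (from-no (+ 2 ≈? 0ℤ [ 3 ]))))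

    -- An even `m` is excluded: 2 is not 1 modulo 3, and a larger even `m` would be the product of
    -- the good integers 2 and m/2. For odd `m` the number m + 1 is such a product, since (m + 1)/2
    -- is still below `m`.
    even-or-odd : (∃[ j ] m ≡ j ℕ.* 2) ⊎ Odd m → + m ≈ 1ℤ [ 3 ] → L (+ suc m)
    even-or-odd (inj₁ (zero , m≡0))  _   = contradiction m≡0 m≢0
    even-or-odd (inj₁ (1 , refl))    m≈1 = contradiction m≈1 (from-no (+ 2 ≈? 1ℤ [ 3 ]))
    even-or-odd (inj₁ (j@(suc (suc j′)) , m≡2j)) _ = contradiction
      (subst (λ m → L (+ m)) (sym m≡2j) (double j
        (subst (j ℕ.<_) (sym m≡2j) (ℕₚ.m<m*n j 2 (ℕ.s≤s (ℕ.s≤s ℕ.z≤n))))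
        (subst (2 ℕ.<_) (sym m≡2j) (ℕ.s≤s (ℕ.s≤s (ℕ.s≤s ℕ.z≤n))))
        (subst (λ m → ¬ (+ m ≈ 0ℤ [ 3 ])) m≡2j m≉0)))
      m-bad
    even-or-odd (inj₂ (zero , m≡1))  _   = contradiction m≡1 m≢1
    even-or-odd (inj₂ (j@(suc j′) , m≡1+2j)) m≈1 =
      subst (λ m → L (+ suc m)) (sym m≡1+2j) (double (suc j)
        (subst (suc j ℕ.<_) (sym m≡1+2j) (ℕ.s≤s (ℕ.s≤s (ℕ.s≤s (ℕₚ.m≤m*n j′ 2)))))
        (subst (2 ℕ.<_) (sym m≡1+2j) (ℕ.s≤s (ℕ.s≤s (ℕ.s≤s ℕ.z≤n))))
        (subst (λ m → ¬ (+ suc m ≈ 0ℤ [ 3 ])) m≡1+2j λ z →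
          from-no (+ 2 ≈? 0ℤ [ 3 ]) (≈-trans (≈-sym (+-cong (≈-refl {x = 1ℤ}) m≈1)) z)))

    successor : + m ≈ 1ℤ [ 3 ] → L (+ m + 1ℤ)
    successor m≈1 = subst L (ℤₚ.+-comm 1ℤ (+ m)) (even-or-odd (parity m) m≈1)

    result : ∃ (Witness N)
    result with mod-3 (+ m)
    ... | inj₁ m≈0         = contradiction m≈0 m≉0
    -- Negation moves `m` into the class of -1 modulo 3, and M - 1 becomes minus the successor of
    -- `m`.
    ... | inj₂ (inj₁ m≈1)  = - + m , record
      { M≈-1 = neg-cong m≈1 ; M-unit = neg-unit m-unit ; M-nonedge = m-bad ∘ triple-neg⁻
      ; M-1-edge = subst L (lemma (+ m)) (triple-neg (successor m≈1)) }
      where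
      lemma : ∀ x → - (x + 1ℤ) ≡ - x - 1ℤ
      lemma = solve-∀
    ... | inj₂ (inj₂ m≈-1) = + m , record
      { M≈-1 = m≈-1 ; M-unit = m-unit ; M-nonedge = m-bad ; M-1-edge = predecessor m≈-1 }

  witness : ∃ (Witness N)
  witness = least-bad⇒witness (least bad? N N-bad)

-- A directed triangle of squares modulo a prime power

succ₃ : Fin 3 → Fin 3
succ₃ 0F = 1F
succ₃ 1F = 2F
succ₃ 2F = 0F

succ₃-≈ : ∀ r → ⟦ succ₃ r ⟧ ≈ 1ℤ + ⟦ r ⟧ [ 3 ]
succ₃-≈ 0F = ≈-refl
succ₃-≈ 1F = ≈-refl
succ₃-≈ 2F = congruent (divides -1ℤ refl)

residue₃-succ : ∀ {x y} → x - y ≈ 1ℤ [ 3 ] → residue 3 x ≡ succ₃ (residue 3 y)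
residue₃-succ {x} {y} x-y≈1 = residue-toℕ (begin
  x                         ≡⟨ lemma x y ⟩
  x - y + y                 ≈⟨ +-cong x-y≈1 (≈-sym (residue-≈ y)) ⟩
  1ℤ + ⟦ residue 3 y ⟧      ≈⟨ succ₃-≈ (residue 3 y) ⟨
  ⟦ succ₃ (residue 3 y) ⟧   ∎)
  where
  open ≈-Reasoning 3
  lemma : ∀ x y → x ≡ x - y + y
  lemma = solve-∀

record SquareTriangle (A : ℕ) : Set where
  field
    layer      : Fin 3 → ℤ
    layer-step : ∀ r → Square[ A ] (layer (succ₃ r) - layer r)

-- The triangle is 0, 1, w for the least nonsquare w, so that 1, w - 1 and - w
-- are squares.
squareTriangle : ∀ k (let p = suc (suc (k ℕ.* 2) ℕ.* 2)) → Prime p → ∀ a →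
                 .{{_ : NonZero (p ^ suc a)}} → SquareTriangle (p ^ suc a)
-- The search variable y stands for the integer y + 1, so the bound p - 2 stands for p - 1, which is
-- the nonsquare -1 modulo `p`.
squareTriangle k p-prime a = from-least (least nonsquare? (ℕ.pred (ℕ.pred p)) p-1-nonsquare)
  where
  p = suc (suc (k ℕ.* 2) ℕ.* 2)
  A = p ^ suc a
  p∣A : + p ∣ℤ + A
  p∣A = ∣ℕ⇒∣ (∣ℕ.m∣m*n (p ^ a))

  nonsquare? : ∀ y → Dec (¬ Square[ A ] (+ suc y))
  nonsquare? y = ¬? (square? (+ suc y))

  p-1-nonsquare : ¬ Square[ A ] (+ ℕ.pred p)
  p-1-nonsquare s = -1-nonsquare k p-prime (square-resp
    (+-cong {n = p} {x = + p} {u = -1ℤ} (∣⇒≈0 ∣ℤ.∣-refl) ≈-refl) (square-weaken p∣A s))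

  from-least : Least (λ y → ¬ Square[ A ] (+ suc y)) → SquareTriangle A
  from-least (zero  , ns , _)     = contradiction 1-square ns
  from-least (suc y , ns , below) = record
    { layer      = λ { 0F → 0ℤ ; 1F → 1ℤ ; 2F → + w }
    ; layer-step = λ { 0F → 1-square ; 1F → w-1-square ; 2F → -w-square } }
    where
    w = suc (suc y)

    w-1-square : Square[ A ] (+ suc y)
    w-1-square = decidable-stable (square? (+ suc y)) (below y ℕₚ.≤-refl)

    w<p : w ℕ.< p
    w<p with w ℕₚ.<? p
    ... | yes w<p = w<p
    -- Otherwise the nonsquare p - 1 would lie below the least nonsquare.
    ... | no  w≮p = contradiction p-1-nonsquare (below (ℕ.pred (ℕ.pred p)) (ℕ.s≤s⁻¹ (ℕₚ.≮⇒≥ w≮p)))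

    w≉0 : ¬ (+ w ≈ 0ℤ [ p ])
    w≉0 = positive-≉0 w<p

    -w-square : Square[ A ] (- + w)
    -w-square = ⊎.[ (λ s → contradiction s ns) , (λ s → s) ]′ (signed-square k p-prime {+ w} a w≉0)

-- Chinese remaindering

module ChineseRemainder {A N : ℕ} (coprime : Coprime A N) where
  private
    s = proj₁ (bézout coprime)
    t = proj₁ (proj₂ (bézout coprime))
    As+Nt≡1 : + A * s + + N * t ≡ 1ℤ
    As+Nt≡1 = proj₂ (proj₂ (bézout coprime))

  -- By the Bézout relation, N t is 1 modulo `A` and 0 modulo `N`, and A s is the reverse.
  combine : ℤ → ℤ → ℤ
  combine x y = x * (+ N * t) + y * (+ A * s)

  private
    split : ∀ z → z ≡ + A * z * s + + N * z * t
    split z = begin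
      z                              ≡⟨ ℤₚ.*-identityˡ z ⟨
      1ℤ * z                         ≡⟨ cong (_* z) As+Nt≡1 ⟨
      (+ A * s + + N * t) * z        ≡⟨ lemma (+ A) (+ N) s t z ⟩
      + A * z * s + + N * z * t      ∎
      where
      open ≡-Reasoning
      lemma : ∀ a n s t z → (a * s + n * t) * z ≡ a * z * s + n * z * t
      lemma = solve-∀

  combine-≈ˡ : ∀ x y → combine x y ≈ x [ A ]
  combine-≈ˡ x y = congruent (divides ((y - x) * s) (begin
    x * (+ N * t) + y * (+ A * s) - x                                   ≡⟨ cong (λ z → x * (+ N * t) + y * (+ A * s) - z) (ℤₚ.*-identityʳ x) ⟨
    x * (+ N * t) + y * (+ A * s) - x * 1ℤ                              ≡⟨ cong (λ z → x * (+ N * t) + y * (+ A * s) - x * z) As+Nt≡1 ⟨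
    x * (+ N * t) + y * (+ A * s) - x * (+ A * s + + N * t)             ≡⟨ lemma x y (+ A) (+ N) s t ⟩
    (y - x) * s * + A                                                   ∎))
    where
    open ≡-Reasoning
    lemma : ∀ x y a n s t → x * (n * t) + y * (a * s) - x * (a * s + n * t) ≡ (y - x) * s * a
    lemma = solve-∀

  combine-≈ʳ : ∀ x y → combine x y ≈ y [ N ]
  combine-≈ʳ x y = congruent (divides ((x - y) * t) (begin
    x * (+ N * t) + y * (+ A * s) - y                                   ≡⟨ cong (λ z → x * (+ N * t) + y * (+ A * s) - z) (ℤₚ.*-identityʳ y) ⟨
    x * (+ N * t) + y * (+ A * s) - y * 1ℤ                              ≡⟨ cong (λ z → x * (+ N * t) + y * (+ A * s) - y * z) As+Nt≡1 ⟨
    x * (+ N * t) + y * (+ A * s) - y * (+ A * s + + N * t)             ≡⟨ lemma x y (+ A) (+ N) s t ⟩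
    (x - y) * t * + N                                                   ∎))
    where
    open ≡-Reasoning
    lemma : ∀ x y a n s t → x * (n * t) + y * (a * s) - y * (a * s + n * t) ≡ (x - y) * t * n
    lemma = solve-∀

  -- With z = x - y, the Bézout relation gives z = A z s + N z t. The first term is divisible by A N
  -- because `N` divides z, the second because `A` does.
  ≈-product : ∀ {x y} → x ≈ y [ A ] → x ≈ y [ N ] → x ≈ y [ A ℕ.* N ]
  ≈-product {x} {y} (congruent d) (congruent e) = congruent (subst (+ (A ℕ.* N) ∣ℤ_) (sym (split (x - y)))
    (∣ℤ.∣m∣n⇒∣m+n
      (∣ℤ.∣m⇒∣m*n s (*-∣-* {A} {N} ∣ℤ.∣-refl e))
      (∣ℤ.∣m⇒∣m*n t (subst (λ m → + m ∣ℤ + N * (x - y)) (ℕₚ.*-comm N A) (*-∣-* {N} {A} ∣ℤ.∣-refl d)))))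

  unit-product : ∀ {u} → Unit[ A ] u → Unit[ N ] u → Unit[ A ℕ.* N ] u
  unit-product {u} (unit i p) (unit j q) = unit (combine i j) (≈-product
    (≈-trans (*-cong (≈-refl {x = u}) (combine-≈ˡ i j)) p)
    (≈-trans (*-cong (≈-refl {x = u}) (combine-≈ʳ i j)) q))

  square-product : ∀ {x} → Square[ A ] x → Square[ N ] x → Square[ A ℕ.* N ] x
  square-product {x} (square u U p) (square v V q) = square w
    (unit-product (unit-resp (≈-sym (combine-≈ˡ u v)) U) (unit-resp (≈-sym (combine-≈ʳ u v)) V))
    (≈-product (≈-trans p (≈-sym (*-cong (combine-≈ˡ u v) (combine-≈ˡ u v))))
               (≈-trans q (≈-sym (*-cong (combine-≈ʳ u v) (combine-≈ʳ u v)))))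
    where w = combine u v

-- Embedding the pentagon

module _ {A N : ℕ} .{{_ : NonZero (A ℕ.* N)}} (A≢1 : A ≢ 1) (coprime : Coprime A N)
         (-1∉A : ¬ Square[ A ] -1ℤ) (triangle : SquareTriangle A) where
  open ChineseRemainder coprime
  open SquareTriangle triangle
  open Graph (QuadraticUnitaryCayley (A ℕ.* N)) using (Adj)
  private
    n = A ℕ.* N

    A∣n : + A ∣ℤ + n
    A∣n = ∣ℕ⇒∣ (∣ℕ.m∣m*n N)

    N∣n : + N ∣ℤ + n
    N∣n = ∣ℕ⇒∣ (∣ℕ.n∣m*n A)

    height : ℤ → ℤ
    height x = layer (residue 3 x)

    lift : ℤ → ℤ
    lift x = combine (height x) x

    lift-≈ˡ : ∀ x y → lift x - lift y ≈ height x - height y [ A ]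
    lift-≈ˡ x y = -‿cong (combine-≈ˡ (height x) x) (combine-≈ˡ (height y) y)

    lift-≈ʳ : ∀ x y → lift x - lift y ≈ x - y [ N ]
    lift-≈ʳ x y = -‿cong (combine-≈ʳ (height x) x) (combine-≈ʳ (height y) y)

    neg-sub : ∀ x y → - (x - y) ≡ y - x
    neg-sub = solve-∀

    height-step : ∀ {x y} → x - y ≈ 1ℤ [ 3 ] → Square[ A ] (height x - height y)
    height-step {x} {y} e = subst (λ r → Square[ A ] (layer r - height y)) (sym (residue₃-succ {x} {y} e)) (layer-step (residue 3 y))

    height-step⁻ : ∀ {x y} → x - y ≈ -1ℤ [ 3 ] → Square[ A ] (height y - height x)
    height-step⁻ {x} {y} e = height-step {y} {x} (≈-trans (≈-reflexive (sym (neg-sub x y))) (neg-cong e))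

    forward : ∀ x y → x - y ≈ 1ℤ [ 3 ] → Square[ N ] (x - y) → Square[ n ] (lift x - lift y)
    forward x y e s = square-product (square-resp (≈-sym (lift-≈ˡ x y)) (height-step {x} {y} e))
                                         (square-resp (≈-sym (lift-≈ʳ x y)) s)

    -- Modulo `A` only the step forward in the triangle survives. If x ≡ y modulo 3, the two heights
    -- agree and their difference is no unit. If x - y ≡ -1, both the height difference and its
    -- negative would be squares, and so would -1.
    backward : ∀ x y → Square[ n ] (lift x - lift y) → TripleSquare[ N ] (x - y)
    backward x y s with mod-3 (x - y)
    ... | inj₁ e = contradiction (unit-∣⇒≡1 (square⇒unit sA) ∣ℤ.∣-refl (≈0⇒∣ (≈⇒-≈0 {x = height x} (≈-reflexive same)))) A≢1
      where
      sA : Square[ A ] (height x - height y)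
      sA = square-resp (lift-≈ˡ x y) (square-weaken A∣n s)
      same : height x ≡ height y
      same = cong layer (residue-toℕ (≈-trans (-≈0⇒≈ {x = x} e) (≈-sym (residue-≈ y))))
    ... | inj₂ (inj₁ e) = inj₁ (e , square-resp (lift-≈ʳ x y) (square-weaken N∣n s))
    ... | inj₂ (inj₂ e) = contradiction
          (square-cancelˡ (square-resp (lift-≈ˡ x y) (square-weaken A∣n s))
            (subst Square[ A ] (lemma (height x) (height y)) (height-step⁻ {x} {y} e))) -1∉A
      where
      lemma : ∀ x y → y - x ≡ (x - y) * -1ℤ
      lemma = solve-∀

    signed⁺ : ∀ x y → TripleSquare[ N ] (x - y) → SignedSquare[ n ] (lift x - lift y)
    signed⁺ x y (inj₁ (e , s)) = inj₁ (forward x y e s)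
    signed⁺ x y (inj₂ (e , s)) = inj₂ (subst Square[ n ] (sym (neg-sub (lift x) (lift y)))
      (forward y x (≈-trans (≈-reflexive (sym (neg-sub x y))) (neg-cong e)) (subst Square[ N ] (neg-sub x y) s)))

    signed⁻ : ∀ x y → SignedSquare[ n ] (lift x - lift y) → TripleSquare[ N ] (x - y)
    signed⁻ x y (inj₁ s) = backward x y s
    signed⁻ x y (inj₂ s) = subst TripleSquare[ N ] (neg-sub y x)
      (triple-neg (backward y x (subst Square[ n ] (neg-sub (lift x) (lift y)) s)))

    residue-difference : ∀ x y → x - y ≈ ⟦ residue n x ⟧ - ⟦ residue n y ⟧ [ n ]
    residue-difference x y = ≈-sym (-‿cong (residue-≈ x) (residue-≈ y))

  vertex : ℤ → Fin n
  vertex x = residue n (lift x)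

  vertex-adj : ∀ x y → TripleSquare[ N ] (x - y) → Adj (vertex x) (vertex y)
  vertex-adj x y l = signedSquare⇒adj n
    (λ e → n≢1 (unit-∣⇒≡1 (signedSquare⇒unit s) ∣ℤ.∣-refl (≈0⇒∣ (≈⇒-≈0 (residue-injective {x = lift x} {lift y} e)))))
    (signedSquare-resp (residue-difference (lift x) (lift y)) s)
    where
    s : SignedSquare[ n ] (lift x - lift y)
    s = signed⁺ x y l
    n≢1 : n ≢ 1
    n≢1 = A≢1 ∘ ℕₚ.m*n≡1⇒m≡1 A N

  vertex-adj⁻ : ∀ x y → Adj (vertex x) (vertex y) → TripleSquare[ N ] (x - y)
  vertex-adj⁻ x y adj = signed⁻ x y
    (signedSquare-resp (≈-sym (residue-difference (lift x) (lift y))) (adj⇒signedSquare n adj))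

  witness⇒¬perfect : ∃ (Witness N) → ¬ Perfect (QuadraticUnitaryCayley n)
  witness⇒¬perfect (M , W) = pentagon⇒¬perfect (QuadraticUnitaryCayley n) (vertex ∘ v) edges nonedges
    where
    open Witness W
    L = TripleSquare[ N ]

    -- The differences along the cycle are -(M - 1), -1, -(M - 1), -(M - 1)² and M²; the last is 1
    -- modulo 3 and the square of a unit.
    v : Fin 5 → ℤ
    v 0F = 0ℤ
    v 1F = M - 1ℤ
    v 2F = M
    v 3F = + 2 * M - 1ℤ
    v 4F = M * M

    edges : ∀ i → Adj (vertex (v i)) (vertex (v (next i)))
    edges 0F = vertex-adj (v 0F) (v 1F) (subst L (lemma M) (triple-neg M-1-edge))
      where
      lemma : ∀ M → - (M - 1ℤ) ≡ 0ℤ - (M - 1ℤ)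
      lemma = solve-∀
    edges 1F = vertex-adj (v 1F) (v 2F) (subst L (lemma M) (triple-neg triple-1))
      where
      lemma : ∀ M → -1ℤ ≡ M - 1ℤ - M
      lemma = solve-∀
    edges 2F = vertex-adj (v 2F) (v 3F) (subst L (lemma M) (triple-neg M-1-edge))
      where
      lemma : ∀ M → - (M - 1ℤ) ≡ M - (+ 2 * M - 1ℤ)
      lemma = solve-∀
    edges 3F = vertex-adj (v 3F) (v 4F) (subst L (lemma M) (triple-neg (triple-* M-1-edge M-1-edge)))
      where
      lemma : ∀ M → - ((M - 1ℤ) * (M - 1ℤ)) ≡ + 2 * M - 1ℤ - M * M
      lemma = solve-∀
    edges 4F = vertex-adj (v 4F) (v 0F) (subst L (lemma M) (inj₁ (*-cong M≈-1 M≈-1 , unit⇒square M-unit)))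
      where
      lemma : ∀ M → M * M ≡ M * M - 0ℤ
      lemma = solve-∀

    nonedges : ∀ i → ¬ Adj (vertex (v i)) (vertex (v (next (next i))))
    nonedges 0F adj = M-nonedge (triple-neg⁻ (subst L (lemma M) (vertex-adj⁻ (v 0F) (v 2F) adj)))
      where
      lemma : ∀ M → 0ℤ - M ≡ - M
      lemma = solve-∀
    nonedges 1F adj = M-nonedge (triple-neg⁻ (subst L (lemma M) (vertex-adj⁻ (v 1F) (v 3F) adj)))
      where
      lemma : ∀ M → M - 1ℤ - (+ 2 * M - 1ℤ) ≡ - M
      lemma = solve-∀
    -- The factor M - 1 is a triple square, so it can be cancelled from M - M² = -(M - 1) M, which
    -- leaves the nonedge `M`.
    nonedges 2F adj = M-nonedge (triple-cancelˡ M-1-edge (triple-neg⁻ (subst L (lemma M) (vertex-adj⁻ (v 2F) (v 4F) adj))))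
      where
      lemma : ∀ M → M - M * M ≡ - ((M - 1ℤ) * M)
      lemma = solve-∀
    -- For M ≡ -1 modulo 3 the last two diagonals, 2 M - 1 and M² - M + 1, are multiples of 3.
    nonedges 3F adj = triple-≉0 (begin
        + 2 * M - 1ℤ - 0ℤ    ≈⟨ -‿cong (-‿cong (*-cong (≈-refl {x = + 2}) M≈-1) (≈-refl {x = 1ℤ})) (≈-refl {x = 0ℤ}) ⟩
        -[1+ 2 ]             ≈⟨ congruent (divides -1ℤ refl) ⟩
        0ℤ                   ∎) (vertex-adj⁻ (v 3F) (v 0F) adj)
      where open ≈-Reasoning 3
    nonedges 4F adj = triple-≉0 (begin
        M * M - (M - 1ℤ)     ≈⟨ -‿cong (*-cong M≈-1 M≈-1) (-‿cong M≈-1 (≈-refl {x = 1ℤ})) ⟩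
        + 3                  ≈⟨ congruent (divides 1ℤ refl) ⟩
        0ℤ                   ∎) (vertex-adj⁻ (v 4F) (v 1F) adj)
      where open ≈-Reasoning 3

-- The least prime factor and the case distinction

3+4k : ∀ k → suc (suc (k ℕ.* 2) ℕ.* 2) ≡ 3 ℕ.+ k ℕ.* 4
3+4k = ℕ-Solver.solve-∀

%4≡3⇒form : ∀ {p} → p % 4 ≡ 3 → ∃[ k ] p ≡ suc (suc (k ℕ.* 2) ℕ.* 2)
%4≡3⇒form {p} p%4≡3 = p ℕ./ 4 ,
  trans (m≡m%n+[m/n]*n p 4) (trans (cong (ℕ._+ p ℕ./ 4 ℕ.* 4) p%4≡3) (sym (3+4k (p ℕ./ 4))))

form⇒%4≡3 : ∀ k → suc (suc (k ℕ.* 2) ℕ.* 2) % 4 ≡ 3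
form⇒%4≡3 k = trans (cong (_% 4) (3+4k k)) ([m+kn]%n≡m%n 3 k 4)

-- `isLeast` compares with every divisor exceeding 1, prime or not, because it is applied to the
-- clique number, of which only divisibility and the bound 2 are known.
record LeastPrimeFactor (n : ℕ) : Set where
  field
    factor   : ℕ
    isPrime  : Prime factor
    factor∣n : factor ∣ n
    isLeast  : ∀ d → 1 ℕ.< d → d ∣ n → factor ℕ.≤ d

leastPrimeFactor : ∀ {n} → 1 ℕ.< n → LeastPrimeFactor n
leastPrimeFactor {n} 1<n
  with q , (1<q , q∣n) , below ← least (λ d → (1 ℕₚ.<? d) ×-dec (d ∣ℕ.∣? n)) n (1<n , ∣ℕ.∣-refl) = record
  { factor  = q
  ; isPrime = prime {{ℕ.n>1⇒nonTrivial 1<q}}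
      λ { (composite {d} d<q d∣q) → below d d<q (ℕ.nonTrivial⇒n>1 d , ∣ℕ.∣-trans d∣q q∣n) }
  ; factor∣n = q∣n
  ; isLeast = λ d 1<d d∣n → ℕₚ.≮⇒≥ λ d<q → below d d<q (1<d , d∣n)
  }

split-power : ∀ {q} → 1 ℕ.< q → ∀ n → .{{NonZero n}} → ∃₂ λ a N → n ≡ q ^ a ℕ.* N × ¬ q ∣ N
split-power {q} 1<q = <-rec (λ n → .{{NonZero n}} → ∃₂ λ a N → n ≡ q ^ a ℕ.* N × ¬ q ∣ N) step
  where
  step : ∀ n → (∀ {i} → i ℕ.< n → .{{NonZero i}} → ∃₂ λ a N → i ≡ q ^ a ℕ.* N × ¬ q ∣ N) →
         .{{NonZero n}} → ∃₂ λ a N → n ≡ q ^ a ℕ.* N × ¬ q ∣ N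
  step n rec with q ∣ℕ.∣? n
  ... | no  q∤n = 0 , n , sym (ℕₚ.+-identityʳ n) , q∤n
  ... | yes (∣ℕ.divides i@(suc _) refl) with a , N , i≡ , q∤N ← rec (ℕₚ.m<m*n i q 1<q) =
    suc a , N , trans (ℕₚ.*-comm i q) (trans (cong (q ℕ.*_) i≡) (sym (ℕₚ.*-assoc q (q ^ a) N))) , q∤N

coprime-^ : ∀ {m n} a → Coprime m n → Coprime m (n ^ a)
coprime-^ zero    c (_ , d∣1) = ∣ℕ.∣1⇒≡1 d∣1
coprime-^ (suc a) c (d∣m , d∣nnᵃ) =
  coprime-^ a c (d∣m , coprime-divisor (λ (e∣d , e∣n) → c (∣ℕ.∣-trans e∣d d∣m , e∣n)) d∣nnᵃ)

mixed⇒¬perfect : ∀ k (let p = suc (suc (k ℕ.* 2) ℕ.* 2)) → Prime p → ∀ a N →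
  .{{_ : NonZero (p ^ suc a ℕ.* N)}} → N ≢ 1 → ¬ 2 ∣ N → ¬ 3 ∣ N → ¬ p ∣ N →
  ¬ Perfect (QuadraticUnitaryCayley (p ^ suc a ℕ.* N))
mixed⇒¬perfect k p-prime a N N≢1 2∤N 3∤N p∤N = witness⇒¬perfect {A} {N}
  (λ A≡1 → prime≢1 p-prime (ℕₚ.m*n≡1⇒m≡1 p (p ^ a) A≡1))
  (Coprime.sym (coprime-^ (suc a) (∤⇒coprime p-prime p∤N)))
  (-1-nonsquare k p-prime ∘ square-weaken (∣ℕ⇒∣ (∣ℕ.m∣m*n (p ^ a))))
  (squareTriangle k p-prime a {{ℕₚ.m*n≢0⇒m≢0 A}})
  (witness {{ℕₚ.m*n≢0⇒n≢0 A}} N≢1 2∤N 3∤N)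
  where
  p = suc (suc (k ℕ.* 2) ℕ.* 2)
  A = p ^ suc a

-- Taking the parity of q and then of (q - 1)/2 reads off the class of q modulo 4.
perfect-odd : ∀ n .{{_ : NonZero n}} {q} → Perfect (QuadraticUnitaryCayley n) → ¬ 2 ∣ n → Prime q → q ∣ n →
  (∀ d → 1 ℕ.< d → d ∣ n → q ℕ.≤ d) → ∃₂ λ p m → Prime p × p % 4 ≡ 3 × n ≡ p ^ m
perfect-odd n {p} perfect 2∤n q-prime q∣n least with parity p
... | inj₁ (j , refl) = contradiction (∣ℕ.∣-trans (∣ℕ.n∣m*n j) q∣n) 2∤n
... | inj₂ (h , refl) with parity h
...   | inj₁ (zero , refl)  = contradiction refl (prime≢1 q-prime)
...   | inj₁ (suc k , refl) = contradiction perfect (prime-1mod4⇒¬perfect n k q-prime q∣n least)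
...   | inj₂ (k , refl)     = power-of-q (split-power (ℕ.s≤s (ℕ.s≤s ℕ.z≤n)) n)
  where
  q : ℕ
  q = suc (suc (k ℕ.* 2) ℕ.* 2)
  power-of-q : (∃₂ λ a N → n ≡ q ^ a ℕ.* N × ¬ q ∣ N) → ∃₂ λ p m → Prime p × p % 4 ≡ 3 × n ≡ p ^ m
  power-of-q (a , N , n≡ , q∤N) with N ℕₚ.≟ 1
  power-of-q (a , N , n≡ , q∤N) | yes refl = q , a , q-prime , form⇒%4≡3 k , trans n≡ (ℕₚ.*-identityʳ (q ^ a))
  power-of-q (zero , N , n≡ , q∤N) | no N≢1 = contradiction (subst (q ∣_) (trans n≡ (ℕₚ.*-identityˡ N)) q∣n) q∤N
  power-of-q (suc a , N , refl , q∤N) | no N≢1 = contradiction perfect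
    (mixed⇒¬perfect k q-prime a N N≢1 (2∤n ∘ ∣ℕ.∣n⇒∣m*n (q ^ suc a)) 3∤N q∤N)
    where
    -- If 3 divided `N`, minimality would give q ≤ 3, hence q = 3, which does not divide `N`.
    3∤N : ¬ 3 ∣ N
    3∤N 3∣N = q∤N (subst (_∣ N) (sym q≡3) 3∣N)
      where
      q≡3 : q ≡ 3
      q≡3 = ℕₚ.≤-antisym (least 3 (ℕ.s≤s (ℕ.s≤s ℕ.z≤n)) (∣ℕ.∣n⇒∣m*n (q ^ suc a) 3∣N)) (ℕ.s≤s (ℕ.s≤s (ℕ.s≤s ℕ.z≤n)))

theorem12 : (n : ℕ) .{{_ : NonZero n}} →
    Perfect (QuadraticUnitaryCayley n) ⇔
    (2 ∣ n ⊎ ∃₂ λ p m → Prime p × p % 4 ≡ 3 × n ≡ p ^ m)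
theorem12 n = mk⇔ to from
  where
  from : 2 ∣ n ⊎ (∃₂ λ p m → Prime p × p % 4 ≡ 3 × n ≡ p ^ m) → Perfect (QuadraticUnitaryCayley n)
  from (inj₁ 2∣n) = even⇒perfect n 2∣n
  from (inj₂ (p , m , p-prime , p%4≡3 , refl)) with k , refl ← %4≡3⇒form {p} p%4≡3 =
    prime-power⇒perfect k p-prime m

  to : Perfect (QuadraticUnitaryCayley n) → 2 ∣ n ⊎ ∃₂ λ p m → Prime p × p % 4 ≡ 3 × n ≡ p ^ m
  to perfect with 2 ∣ℕ.∣? n | 1 ℕₚ.<? n
  ... | yes 2∣n | _       = inj₁ 2∣n
  -- The case n = 1 counts as the power 3^0.
  ... | no  _   | no  1≮n = inj₂ (3 , 0 , from-yes (prime? 3) , refl ,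
                              ℕₚ.≤-antisym (ℕₚ.≮⇒≥ 1≮n) (ℕ.>-nonZero⁻¹ n))
  ... | no  2∤n | yes 1<n = inj₂ (perfect-odd n perfect 2∤n isPrime factor∣n isLeast)
    where open LeastPrimeFactor (leastPrimeFactor 1<n)
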